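{- Let $\mathcal{K}$ be a class of finite $\mathcal{R}$-structures and let $\mathbf{A}\in\mathcal{K}$. Suppose $\mathcal{K}$ is closed under forming the $n$-pinch construction over $\mathbf{A}$ and under taking disjoint unions. Then $\mathbb{H}^{\gets}_{\mathcal{K}}(\mathbf{A})=\mathcal{K}\cap\operatorname{Mod}(\phi)$ for some first-order sentence $\phi$ if and only if there is a finite conjunction of anti-identities $\psi$ such that $\mathbb{H}^{\gets}_{\mathcal{K}}(\mathbf{A})=\mathcal{K}\cap\operatorname{Mod}(\psi)$.
   Context: $\mathcal{R}=\{R_1,\dots,R_m\}$ is a finite purely relational signature, $R_i$ of arity $r_i\ge1$; all structures are finite. $\mathbb{H}^{\gets}_{\mathcal{K}}(\mathbf{A})$ is the class of all $\mathbf{B}\in\mathcal{K}$ admitting a homomorphism to $\mathbf{A}$. An anti-identity is a sentence $\forall x_1,\dots,x_n\,[\neg\alpha_1\vee\dots\vee\neg\alpha_k]$ with $n\ge0$, $k\ge1$, each $\alpha_i$ atomic in $x_1,\dots,x_n$. For $n\in\mathbb{N}$, the $n$-link is $\mathbf{L}_n=\langle\{0,1,\dots,n\};R_1^{\mathbf{L}_n},\dots,R_m^{\mathbf{L}_n}\rangle$ with $R_i^{\mathbf{L}_n}=\bigcup_{j=1}^n\{j-1,j\}^{r_i}$. On the product structure $\mathbf{L}_n\times\mathbf{A}\times\mathbf{A}$ define the equivalence $(i,a,b)\sim_n(i',a',b')$ iff either they are equal, or $i=i'=0$ and $a=a'$, or $i=i'=n$ and $b=b'$. The $n$-pinch over $\mathbf{A}$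 is the quotient structure $\mathbf{P}_n(\mathbf{A})=(\mathbf{L}_n\times\mathbf{A}\times\mathbf{A})/\sim_n$ (a tuple of classes is in a relation iff some choice of representatives is in the relation of the product). $\mathbf{B}_R$ and $\mathbf{B}_L$ are the substructures of $\mathbf{P}_n(\mathbf{A})$ induced by $\{(k,a,b)/\sim_n : k\ne0\}$ and $\{(k,a,b)/\sim_n: k\ne n\}$ respectively. $\mathcal{K}$ is closed under forming the $n$-pinch construction over a class $\mathcal{F}$ if for every $n\in\mathbb{N}$ and every $\mathbf{F}\in\mathcal{F}$, $\mathbf{P}_n(\mathbf{F})$ and its substructures $\mathbf{B}_R$, $\mathbf{B}_L$ belong to $\mathcal{K}$. Closed under disjoint unions means the disjoint union of any two members of $\mathcal{K}$ is in $\mathcal{K}$. -}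

module Defs where

open import Data.Nat using (ℕ; zero; suc; _≡ᵇ_; _≤_)
open import Data.Fin using (Fin; zero; suc; fromℕ; toℕ)
open import Data.Bool using (Bool; true; false; _∧_; _∨_)
open import Data.Vec using (Vec; []; _∷_; map)
open import Data.List using (List; []; _∷_)
open import Data.List.NonEmpty using (List⁺; _∷_)
open import Data.Product using (Σ; ∃; _×_; _,_; proj₁; proj₂)
open import Data.Sum using (_⊎_)
open import Data.Empty using (⊥)
open import Data.Unit using (⊤)
open import Relation.Nullary using (¬_)
open import Relation.Binary.PropositionalEquality using (_≡_)
open import Function using (_∘_)
open import Function.Bundles using (_↔_; _⇔_)
open import Function.Definitions using (Injective; Surjective)

record Signature : Set where
  field
    m     : ℕ
    arity : Fin m → ℕ
open Signature public

record PreStructure (σ : Signature) : Set₁ where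
  field
    Carrier : Set
    rel     : (i : Fin (m σ)) → Vec Carrier (arity σ i) → Bool
open PreStructure public

record Structure (σ : Signature) : Set₁ where
  field
    pre  : PreStructure σ
    size : ℕ
    enum : Fin size ↔ Carrier pre
open Structure public

∣_∣ : {σ : Signature} → Structure σ → Set
∣ B ∣ = Carrier (pre B)

Rel : {σ : Signature} (B : Structure σ) (i : Fin (m σ)) → Vec ∣ B ∣ (arity σ i) → Bool
Rel B = rel (pre B)

IsHom : {σ : Signature} (B A : Structure σ) → (∣ B ∣ → ∣ A ∣) → Set
IsHom {σ} B A f =
  (i : Fin (m σ)) (t : Vec ∣ B ∣ (arity σ i)) →
  Rel B i t ≡ true → Rel A i (map f t) ≡ true

HomTo : {σ : Signature} (B A : Structure σ) → Set
HomTo B A = Σ (∣ B ∣ → ∣ A ∣) (IsHom B A)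

data Formula (σ : Signature) : ℕ → Set where
  relᶠ : ∀ {n} (i : Fin (m σ)) → Vec (Fin n) (arity σ i) → Formula σ n
  _≐_  : ∀ {n} → Fin n → Fin n → Formula σ n
  ⊤ᶠ   : ∀ {n} → Formula σ n
  ⊥ᶠ   : ∀ {n} → Formula σ n
  ¬ᶠ_  : ∀ {n} → Formula σ n → Formula σ n
  _∧ᶠ_ : ∀ {n} → Formula σ n → Formula σ n → Formula σ n
  _∨ᶠ_ : ∀ {n} → Formula σ n → Formula σ n → Formula σ n
  ∃ᶠ   : ∀ {n} → Formula σ (suc n) → Formula σ n
  ∀ᶠ   : ∀ {n} → Formula σ (suc n) → Formula σ n

Sentence : Signature → Set
Sentence σ = Formula σ 0

extend : {X : Set} {n : ℕ} → X → (Fin n → X) → Fin (suc n) → X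
extend x ρ zero    = x
extend x ρ (suc k) = ρ k

⟦_⟧ : {σ : Signature} {n : ℕ} → Formula σ n → (B : Structure σ) → (Fin n → ∣ B ∣) → Set
⟦ relᶠ i xs ⟧ B ρ = Rel B i (map ρ xs) ≡ true
⟦ x ≐ y ⟧    B ρ = ρ x ≡ ρ y
⟦ ⊤ᶠ ⟧       B ρ = ⊤
⟦ ⊥ᶠ ⟧       B ρ = ⊥
⟦ ¬ᶠ φ ⟧     B ρ = ¬ (⟦ φ ⟧ B ρ)
⟦ φ ∧ᶠ ψ ⟧   B ρ = ⟦ φ ⟧ B ρ × ⟦ ψ ⟧ B ρ
⟦ φ ∨ᶠ ψ ⟧   B ρ = ⟦ φ ⟧ B ρ ⊎ ⟦ ψ ⟧ B ρ
⟦ ∃ᶠ φ ⟧     B ρ = Σ ∣ B ∣ (λ b → ⟦ φ ⟧ B (extend b ρ))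
⟦ ∀ᶠ φ ⟧     B ρ = (b : ∣ B ∣) → ⟦ φ ⟧ B (extend b ρ)

noVars : {X : Set} → Fin 0 → X
noVars ()

_⊨_ : {σ : Signature} → Structure σ → Sentence σ → Set
B ⊨ φ = ⟦ φ ⟧ B noVars

data Atom (σ : Signature) (n : ℕ) : Set where
  relA : (i : Fin (m σ)) → Vec (Fin n) (arity σ i) → Atom σ n
  eqA  : Fin n → Fin n → Atom σ n

atomFormula : {σ : Signature} {n : ℕ} → Atom σ n → Formula σ n
atomFormula (relA i xs) = relᶠ i xs
atomFormula (eqA x y)   = x ≐ y

record AntiIdentity (σ : Signature) : Set where
  field
    nvars : ℕ
    atoms : List⁺ (Atom σ nvars)
open AntiIdentity public

closeAll : {σ : Signature} (n : ℕ) → Formula σ n → Sentence σ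
closeAll zero    φ = φ
closeAll (suc n) φ = closeAll n (∀ᶠ φ)

negDisj : {σ : Signature} {n : ℕ} → Atom σ n → List (Atom σ n) → Formula σ n
negDisj α []       = ¬ᶠ atomFormula α
negDisj α (β ∷ βs) = (¬ᶠ atomFormula α) ∨ᶠ negDisj β βs

antiIdentityFormula : {σ : Signature} → AntiIdentity σ → Sentence σ
antiIdentityFormula θ with atoms θ
... | α ∷ αs = closeAll (nvars θ) (negDisj α αs)

conjAI : {σ : Signature} → List (AntiIdentity σ) → Sentence σ
conjAI []       = ⊤ᶠ
conjAI (θ ∷ θs) = antiIdentityFormula θ ∧ᶠ conjAI θs

Defines : {σ : Signature} → (Structure σ → Set) → Structure σ → Sentence σ → Set₁
Defines {σ} K A φ = (B : Structure σ) → K B → (HomTo B A ⇔ (B ⊨ φ))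

-- The n-link L_n : universe {0,...,n} (= Fin (suc n)),
-- R_i^{L_n} = ⋃_{j=1}^{n} {j-1,j}^{r_i}.  Edge j ∈ {1..n} is encoded by
-- e : Fin n with j - 1 = toℕ e.

anyFin : (n : ℕ) → (Fin n → Bool) → Bool
anyFin zero    p = false
anyFin (suc n) p = p zero ∨ anyFin n (p ∘ suc)

allVec : {X : Set} {k : ℕ} → (X → Bool) → Vec X k → Bool
allVec p []       = true
allVec p (x ∷ xs) = p x ∧ allVec p xs

inEdge : {n : ℕ} → Fin n → Fin (suc n) → Bool
inEdge e x = (toℕ x ≡ᵇ toℕ e) ∨ (toℕ x ≡ᵇ suc (toℕ e))

linkRel : (n k : ℕ) → Vec (Fin (suc n)) k → Bool
linkRel n k t = anyFin n (λ e → allVec (inEdge e) t)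

Link : (σ : Signature) (n : ℕ) → PreStructure σ
Link σ n = record { Carrier = Fin (suc n) ; rel = λ i t → linkRel n (arity σ i) t }

Triple : {σ : Signature} → ℕ → Structure σ → Set
Triple n A = Fin (suc n) × ∣ A ∣ × ∣ A ∣

pinchProduct : {σ : Signature} (n : ℕ) (A : Structure σ) → PreStructure σ
pinchProduct {σ} n A = record
  { Carrier = Triple n A
  ; rel = λ i t → linkRel n (arity σ i) (map proj₁ t)
                ∧ Rel A i (map (proj₁ ∘ proj₂) t)
                ∧ Rel A i (map (proj₂ ∘ proj₂) t)
  }

pinchEq : {σ : Signature} (n : ℕ) (A : Structure σ) → Triple n A → Triple n A → Set
pinchEq n A (i , a , b) (i' , a' , b') =
  ((i , a , b) ≡ (i' , a' , b'))
  ⊎ ((i ≡ zero) × (i' ≡ zero) × (a ≡ a'))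
  ⊎ ((i ≡ fromℕ n) × (i' ≡ fromℕ n) × (b ≡ b'))

record IsQuotientMap {σ : Signature} (C : PreStructure σ)
    (_≈_ : Carrier C → Carrier C → Set) (Q : Structure σ)
    (q : Carrier C → ∣ Q ∣) : Set where
  field
    surjective : (y : ∣ Q ∣) → Σ (Carrier C) (λ x → q x ≡ y)
    kernel     : (x y : Carrier C) → (q x ≡ q y) ⇔ (x ≈ y)
    relations  : (i : Fin (m σ)) (t : Vec ∣ Q ∣ (arity σ i)) →
                 (Rel Q i t ≡ true) ⇔
                 Σ (Vec (Carrier C) (arity σ i)) (λ s → (rel C i s ≡ true) × (map q s ≡ t))

record IsInducedSubstructure {σ : Signature} (D Q : Structure σ)
    (S : ∣ Q ∣ → Set) : Set where
  field
    emb        : ∣ D ∣ → ∣ Q ∣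
    injective  : (x y : ∣ D ∣) → emb x ≡ emb y → x ≡ y
    image      : (y : ∣ Q ∣) → S y ⇔ Σ ∣ D ∣ (λ x → emb x ≡ y)
    relations  : (i : Fin (m σ)) (t : Vec ∣ D ∣ (arity σ i)) →
                 Rel D i t ≡ Rel Q i (map emb t)

PinchClosed : {σ : Signature} → (Structure σ → Set) → Structure σ → Set₁
PinchClosed {σ} K A =
  (n : ℕ) → 1 ≤ n →
  (Q : Structure σ) (q : Triple n A → ∣ Q ∣) →
  IsQuotientMap (pinchProduct n A) (pinchEq n A) Q q →
    K Q
  × ((D : Structure σ) →
       IsInducedSubstructure D Q (λ y → Σ (Triple n A) (λ x → (q x ≡ y) × ¬ (proj₁ x ≡ zero))) → K D)
  × ((D : Structure σ) →
       IsInducedSubstructure D Q (λ y → Σ (Triple n A) (λ x → (q x ≡ y) × ¬ (proj₁ x ≡ fromℕ n))) → K D)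

record IsDisjointUnion {σ : Signature} (D B C : Structure σ) : Set where
  field
    inl       : ∣ B ∣ → ∣ D ∣
    inr       : ∣ C ∣ → ∣ D ∣
    inl-inj   : (x y : ∣ B ∣) → inl x ≡ inl y → x ≡ y
    inr-inj   : (x y : ∣ C ∣) → inr x ≡ inr y → x ≡ y
    disjoint  : (x : ∣ B ∣) (y : ∣ C ∣) → ¬ (inl x ≡ inr y)
    cover     : (z : ∣ D ∣) → (Σ ∣ B ∣ (λ x → inl x ≡ z)) ⊎ (Σ ∣ C ∣ (λ y → inr y ≡ z))
    relations : (i : Fin (m σ)) (t : Vec ∣ D ∣ (arity σ i)) →
                (Rel D i t ≡ true) ⇔
                (Σ (Vec ∣ B ∣ (arity σ i)) (λ s → (Rel B i s ≡ true) × (map inl s ≡ t))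
                 ⊎ Σ (Vec ∣ C ∣ (arity σ i)) (λ s → (Rel C i s ≡ true) × (map inr s ≡ t)))

DisjointUnionClosed : {σ : Signature} → (Structure σ → Set) → Set₁
DisjointUnionClosed {σ} K =
  (B C D : Structure σ) → K B → K C → IsDisjointUnion D B C → K D

{-# OPTIONS --safe #-}
module Submission where

-- Let φ have quantifier rank q, and let n exceed 2^q. Every disjoint union of half pinches B_L, B_R
-- maps to A, hence satisfies φ. In the Ehrenfeucht–Fraïssé game φ cannot notice an additional whole
-- n-pinch, so P_n(A) maps to A as well. Such a map is a chain G_0, ..., G_n of binary operations,
-- where G_0 ignores its second and G_n its first argument, and neighbouring operations may be mixed
-- on a relation. Given a chain and a structure B:
--  * if n + 1 rounds of arc consistency leave every element of B a possible value in A, then so do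
--    all further rounds, and the final value sets are closed under the chain;
--  * endomorphisms (over B) of the final value sets can be made less and less injective with the
--    help of the chain, until each fibre is mapped to a single value; this is a map B → A.
-- A failure within n + 1 rounds is witnessed by boundedly many elements of B. So B maps to A iff every
-- substructure of B of bounded size does, which is a finite conjunction of anti-identities.

open import Defs
open import Data.Bool using (Bool; true; false; T; _∧_; if_then_else_; not)
open import Data.Bool.Properties using (T-irrelevant; T-≡)
import Data.Bool.Properties as Boolₚ
open import Data.Empty using (⊥; ⊥-elim)
open import Data.Fin
  using (Fin; zero; suc; toℕ; remQuot; combine; funToFin; finToFun; _↑ˡ_; _↑ʳ_; splitAt; fromℕ; fromℕ<)
import Data.Fin.Properties as Finₚ
import Data.Fin.Subset as Sub
import Data.Fin.Subset.Properties as Subₚ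
open import Data.List using (List; []; _∷_; _++_; length; concatMap; filter; allFin)
import Data.List as List
open import Data.List.Membership.Propositional using (_∈_; lose)
open import Data.List.Membership.Propositional.Properties
  using (∈-map⁺; ∈-++⁺ˡ; ∈-++⁺ʳ; ∈-concatMap⁺; ∈-tabulate⁺; ∈-filter⁺; ∈-allFin)
open import Data.List.NonEmpty using (_∷_)
import Data.List.Properties as Listₚ
open import Data.List.Relation.Unary.All using (All; []; _∷_; all?)
import Data.List.Relation.Unary.All as All
open import Data.List.Relation.Unary.All.Properties using (¬All⇒Any¬; Any¬⇒¬All; all-filter; map⁺)
open import Data.List.Relation.Unary.Any using (Any; here; there)
open import Data.Nat using (ℕ; zero; suc; _+_; _*_; _∸_; _^_; _≤_; _<_; z≤n; s≤s; _⊔_; _≡ᵇ_)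
open import Data.Nat.Induction using (<-wellFounded)
import Data.Nat.Properties as ℕₚ
open import Data.Product using (Σ; _×_; _,_; proj₁; proj₂)
open import Data.Sum using (_⊎_; inj₁; inj₂)
open import Data.Unit using (⊤; tt)
open import Data.Vec using (Vec; []; _∷_; lookup; tabulate; map)
import Data.Vec.Properties as Vecₚ
open import Function using (_∘_; id)
open import Function.Bundles using (_↔_; _⇔_; mk⇔; mk↔ₛ′; Equivalence; Inverse)
open import Induction.WellFounded using (Acc; acc)
open import Relation.Binary.PropositionalEquality
  using (_≡_; refl; sym; trans; cong; cong₂; subst; module ≡-Reasoning)
open import Relation.Nullary using (¬_; Dec; yes; no; does)
open import Relation.Nullary.Decidable
  using (map′; _×-dec_; ¬?; decidable-stable; dec-true; _→-dec_)
open import Relation.Unary using (Decidable)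

-- Finite types

Finite : Set → Set
Finite X = Σ ℕ λ n → Fin n ↔ X

to-from : ∀ {X} ((n , e) : Finite X) (x : X) → Inverse.to e (Inverse.from e x) ≡ x
to-from (_ , e) = Inverse.strictlyInverseˡ e

abstract
  finite-≟ : ∀ {X} → Finite X → (x y : X) → Dec (x ≡ y)
  finite-≟ F@(n , e) x y = map′
    (λ eq → trans (sym (to-from F x)) (trans (cong (Inverse.to e) eq) (to-from F y)))
    (cong (Inverse.from e))
    (Inverse.from e x Finₚ.≟ Inverse.from e y)

abstract
  finite-any? : ∀ {X} → Finite X → {P : X → Set} → Decidable P → Dec (Σ X P)
  finite-any? F@(n , e) {P} P? = map′
    (λ (i , p) → Inverse.to e i , p)
    (λ (x , p) → Inverse.from e x , subst P (sym (to-from F x)) p)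
    (Finₚ.any? (P? ∘ Inverse.to e))

abstract
  finite-all? : ∀ {X} → Finite X → {P : X → Set} → Decidable P → Dec (∀ x → P x)
  finite-all? F@(n , e) {P} P? = map′
    (λ h x → subst P (to-from F x) (h (Inverse.from e x)))
    (λ h i → h (Inverse.to e i))
    (Finₚ.all? (P? ∘ Inverse.to e))

abstract
  vec-any? : ∀ {X} → Finite X → ∀ {k} {P : Vec X k → Set} → Decidable P → Dec (Σ (Vec X k) P)
  vec-any? F {zero} P? = map′ (λ p → [] , p) (λ { ([] , p) → p }) (P? [])
  vec-any? F {suc k} P? = map′
    (λ (x , xs , p) → x ∷ xs , p)
    (λ { (x ∷ xs , p) → x , xs , p })
    (finite-any? F λ x → vec-any? F λ xs → P? (x ∷ xs))

abstract
  vec-all? : ∀ {X} → Finite X → ∀ {k} {P : Vec X k → Set} → Decidable P → Dec (∀ v → P v)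
  vec-all? F {zero} P? = map′ (λ { p [] → p }) (λ p → p []) (P? [])
  vec-all? F {suc k} P? = map′
    (λ { p (x ∷ xs) → p x xs })
    (λ p x xs → p (x ∷ xs))
    (finite-all? F λ x → vec-all? F λ xs → P? (x ∷ xs))

finite-Fin : ∀ n → Finite (Fin n)
finite-Fin n = n , mk↔ₛ′ id id (λ _ → refl) (λ _ → refl)

infixr 2 _×-finite_

_×-finite_ : ∀ {X Y} → Finite X → Finite Y → Finite (X × Y)
(m , e) ×-finite (n , f) = m * n , mk↔ₛ′
  (λ i → to e (proj₁ (remQuot {m} n i)) , to f (proj₂ (remQuot {m} n i)))
  (λ (x , y) → combine (from e x) (from f y))
  (λ (x , y) → cong₂ _,_
    (trans (cong (to e ∘ proj₁) (Finₚ.remQuot-combine (from e x) (from f y))) (strictlyInverseˡ e x))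
    (trans (cong (to f ∘ proj₂) (Finₚ.remQuot-combine (from e x) (from f y))) (strictlyInverseˡ f y)))
  (λ i → trans
    (cong₂ combine (strictlyInverseʳ e _) (strictlyInverseʳ f _))
    (Finₚ.combine-remQuot {m} n i))
  where open Inverse

abstract
  Fin-subset-finite : ∀ n (p : Fin n → Bool) → Finite (Σ (Fin n) (T ∘ p))
  Fin-subset-finite zero p = 0 , mk↔ₛ′ (λ ()) (λ ()) (λ ()) (λ ())
  Fin-subset-finite (suc n) p = extend-by (p zero) refl (Fin-subset-finite n (p ∘ suc))
    where
    S : Set
    S = Σ (Fin (suc n)) (T ∘ p)

    extend-by : ∀ b → p zero ≡ b → Finite (Σ (Fin n) (T ∘ p ∘ suc)) → Finite S
    extend-by true p0 (m , e) = suc m , mk↔ₛ′ f g fg gf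
      where
      open Inverse e
      T0 : T (p zero)
      T0 = subst T (sym p0) _
      f : Fin (suc m) → S
      f zero = zero , T0
      f (suc i) = suc (proj₁ (to i)) , proj₂ (to i)
      g : S → Fin (suc m)
      g (zero , _) = zero
      g (suc i , t) = suc (from (i , t))
      fg : ∀ x → f (g x) ≡ x
      fg (zero , t) = cong (zero ,_) (T-irrelevant _ _)
      fg (suc i , t) = cong (λ (j , u) → suc j , u) (strictlyInverseˡ (i , t))
      gf : ∀ i → g (f i) ≡ i
      gf zero = refl
      gf (suc i) = cong suc (strictlyInverseʳ i)
    extend-by false p0 (m , e) = m , mk↔ₛ′ f g fg strictlyInverseʳ
      where
      open Inverse e
      f : Fin m → S
      f i = suc (proj₁ (to i)) , proj₂ (to i)
      g : S → Fin m
      g (zero , t) = ⊥-elim (subst T p0 t)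
      g (suc i , t) = from (i , t)
      fg : ∀ x → f (g x) ≡ x
      fg (zero , t) = ⊥-elim (subst T p0 t)
      fg (suc i , t) = cong (λ (j , u) → suc j , u) (strictlyInverseˡ (i , t))

-- Subsets are cut out by Boolean predicates so that membership proofs are unique and equality rests
-- on the underlying element alone.
Σ-T-≡ : ∀ {X : Set} {p : X → Bool} {u v : Σ X (T ∘ p)} → proj₁ u ≡ proj₁ v → u ≡ v
Σ-T-≡ {u = x , _} refl = cong (x ,_) (T-irrelevant _ _)

abstract
  subset-finite : ∀ {X} → Finite X → (p : X → Bool) → Finite (Σ X (T ∘ p))
  subset-finite {X} F@(n , e) p with Fin-subset-finite n (p ∘ Inverse.to e)
  ... | m , e′ = m , mk↔ₛ′ f g fg gf
    where
    open Inverse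
    pull : (x : X) → T (p x) → T (p (to e (from e x)))
    pull x = subst (T ∘ p) (sym (to-from F x))
    f : Fin m → Σ X (T ∘ p)
    f i = to e (proj₁ (to e′ i)) , proj₂ (to e′ i)
    g : Σ X (T ∘ p) → Fin m
    g (x , t) = from e′ (from e x , pull x t)
    fg : ∀ u → f (g u) ≡ u
    fg (x , t) = Σ-T-≡ (trans
      (cong (to e ∘ proj₁) (strictlyInverseˡ e′ (from e x , pull x t)))
      (to-from F x))
    gf : ∀ i → g (f i) ≡ i
    gf i = trans (cong (from e′) (Σ-T-≡ (strictlyInverseʳ e (proj₁ (to e′ i))))) (strictlyInverseʳ e′ i)

count : ∀ {X} → Finite X → {P : X → Set} → Decidable P → ℕ
count (n , e) P? = Sub.∣ tabulate (λ i → does (P? (Inverse.to e i))) ∣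

-- Supplies the termination measure of both later loops: the shrinking of the value sets and the
-- folding of endomorphisms.
count-< : ∀ {X} (F : Finite X) {P Q : X → Set} (P? : Decidable P) (Q? : Decidable Q) →
  (∀ x → P x → Q x) → ∀ x → Q x → ¬ P x → count F P? < count F Q?
count-< F@(n , e) {P} {Q} P? Q? P⊆Q x Qx ¬Px = Subₚ.p⊂q⇒∣p∣<∣q∣
  ( (λ {i} i∈ → in-Q (P⊆Q _ (out-P i∈)))
  , Inverse.from e x
  , in-Q (subst Q (sym (to-from F x)) Qx)
  , λ i∈ → ¬Px (subst P (to-from F x) (out-P i∈)))
  where
  out-P : ∀ {i} → i Sub.∈ tabulate (λ i → does (P? (Inverse.to e i))) → P (Inverse.to e i)
  out-P {i} i∈ with P? (Inverse.to e i)
                  | trans (sym (Vecₚ.lookup∘tabulate (λ i → does (P? (Inverse.to e i))) i)) (Vecₚ.[]=⇒lookup i∈)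
  ... | yes p | _ = p
  in-Q : ∀ {i} → Q (Inverse.to e i) → i Sub.∈ tabulate (λ i → does (Q? (Inverse.to e i)))
  in-Q {i} q = Vecₚ.lookup⇒[]= i _ (trans (Vecₚ.lookup∘tabulate _ i) (dec-true (Q? (Inverse.to e i)) q))

does⇔ : ∀ {P : Set} (P? : Dec P) → does P? ≡ true ⇔ P
does⇔ P? = mk⇔ (decide P?) (dec-true P?)
  where
  decide : ∀ {P : Set} (P? : Dec P) → does P? ≡ true → P
  decide (yes p) _ = p

does-cong : ∀ {P Q : Set} (P? : Dec P) (Q? : Dec Q) → P ⇔ Q → does P? ≡ does Q?
does-cong (yes p) (yes q) _ = refl
does-cong (yes p) (no ¬q) h = ⊥-elim (¬q (Equivalence.to h p))
does-cong (no ¬p) (yes q) h = ⊥-elim (¬p (Equivalence.from h q))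
does-cong (no ¬p) (no ¬q) _ = refl

lookup-ext : ∀ {X : Set} {k} {v w : Vec X k} → (∀ j → lookup v j ≡ lookup w j) → v ≡ w
lookup-ext {v = v} {w} h =
  trans (sym (Vecₚ.tabulate∘lookup v)) (trans (Vecₚ.tabulate-cong h) (Vecₚ.tabulate∘lookup w))

map-preimage : ∀ {X Y : Set} (g : X → Y) {k} (t : Vec Y k) →
  (∀ j → Σ X λ x → g x ≡ lookup t j) → Σ (Vec X k) λ s → map g s ≡ t
map-preimage g t h = tabulate (proj₁ ∘ h) , lookup-ext λ j →
  trans (Vecₚ.lookup-map j g (tabulate (proj₁ ∘ h))) (trans (cong g (Vecₚ.lookup∘tabulate (proj₁ ∘ h) j)) (proj₂ (h j)))

module _ {X : Set} (f : X → X) where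
  iter : ℕ → X → X
  iter zero x = x
  iter (suc k) x = f (iter k x)

  iter-+ : ∀ j k x → iter (j + k) x ≡ iter j (iter k x)
  iter-+ zero k x = refl
  iter-+ (suc j) k x = cong f (iter-+ j k x)

-- If f^i = f^(i+d) with d ≥ 1, then f^k with k = (i+1)d is idempotent.
abstract
  idempotent-iterate : ∀ {X} → Finite X → (f : X → X) →
    Σ ℕ λ k → ∀ x → iter f (suc k) (iter f (suc k) x) ≡ iter f (suc k) x
  idempotent-iterate {X} F@(n , e) f with Finₚ.pigeonhole (ℕₚ.n<1+n _) code
    where
    open Inverse e
    code : Fin (suc (n ^ n)) → Fin (n ^ n)
    code i = funToFin (λ j → from (iter f (toℕ i) (to j)))
  ... | i′ , j′ , i<j , codes = go (j ∸ i) refl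
    where
    open Inverse e
    i j : ℕ
    i = toℕ i′
    j = toℕ j′
    agree : ∀ x → iter f i x ≡ iter f j x
    agree x = subst (λ y → iter f i y ≡ iter f j y) (to-from F x) (trans (sym (to-from F _)) (trans (cong to
      (trans (sym (Finₚ.finToFun-funToFin (λ j → from (iter f i (to j))) (from x)))
      (trans (cong (λ c → finToFun c (from x)) codes)
        (Finₚ.finToFun-funToFin (λ k → from (iter f j (to k))) (from x))))) (to-from F _)))
    go : ∀ d → d ≡ j ∸ i → Σ ℕ λ k → ∀ x → iter f (suc k) (iter f (suc k) x) ≡ iter f (suc k) x
    go zero eq = ⊥-elim (ℕₚ.<⇒≱ i<j (ℕₚ.m∸n≡0⇒m≤n (sym eq)))
    go (suc d) eq = d + i * suc d , λ x → trans (sym (iter-+ f K K x)) (absorb (suc i) K i≤K x)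
      where
      K : ℕ
      K = suc i * suc d
      i≤K : i ≤ K
      i≤K = ℕₚ.≤-trans (ℕₚ.n≤1+n i) (ℕₚ.m≤m*n (suc i) (suc d))
      step : ∀ t → i ≤ t → ∀ x → iter f (suc d + t) x ≡ iter f t x
      step t i≤t x = begin
        iter f (suc d + t) x              ≡⟨ cong (λ a → iter f (suc d + a) x) (sym (ℕₚ.m∸n+n≡m i≤t)) ⟩
        iter f (suc d + (t ∸ i + i)) x    ≡⟨ cong (λ a → iter f a x) shuffle ⟩
        iter f (t ∸ i + j) x              ≡⟨ iter-+ f (t ∸ i) j x ⟩
        iter f (t ∸ i) (iter f j x)       ≡⟨ cong (iter f (t ∸ i)) (sym (agree x)) ⟩
        iter f (t ∸ i) (iter f i x)       ≡⟨ sym (iter-+ f (t ∸ i) i x) ⟩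
        iter f (t ∸ i + i) x              ≡⟨ cong (λ a → iter f a x) (ℕₚ.m∸n+n≡m i≤t) ⟩
        iter f t x                        ∎
        where
        open ≡-Reasoning
        shuffle : suc d + (t ∸ i + i) ≡ t ∸ i + j
        shuffle = trans (ℕₚ.+-comm (suc d) _) (trans (ℕₚ.+-assoc (t ∸ i) i (suc d))
          (cong (t ∸ i +_) (trans (cong (i +_) eq) (ℕₚ.m+[n∸m]≡n (ℕₚ.<⇒≤ i<j)))))
      absorb : ∀ a t → i ≤ t → ∀ x → iter f (a * suc d + t) x ≡ iter f t x
      absorb zero t _ x = refl
      absorb (suc a) t i≤t x = trans (cong (λ c → iter f c x) (ℕₚ.+-assoc (suc d) (a * suc d) t))
        (trans (step (a * suc d + t) (ℕₚ.≤-trans i≤t (ℕₚ.m≤n+m t _)) x) (absorb a t i≤t x))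

-- Families of pinches

finite : ∀ {σ} (A : Structure σ) → Finite ∣ A ∣
finite A = size A , enum A

module Pinch {σ : Signature} (A : Structure σ) (n′ : ℕ) where

  n : ℕ
  n = suc n′

  Point : Set
  Point = Triple n A

  level : Point → Fin (suc n)
  level = proj₁

  finite-Point : Finite Point
  finite-Point = finite-Fin (suc n) ×-finite finite A ×-finite finite A

  _≟ₚ_ : (x y : Point) → Dec (x ≡ y)
  _≟ₚ_ = finite-≟ finite-Point

  -- A canonical representative of each class of `pinchEq`, so that the quotient becomes a subset.
  -- As `n` is at least 1, the two ends are different levels and their collapsing rules do not
  -- interfere.
  norm : Point → Point
  norm (zero , a , b) = zero , a , a
  norm (suc l , a , b) = suc l , (if does (l Finₚ.≟ fromℕ n′) then b else a) , b

  level-norm : ∀ x → level (norm x) ≡ level x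
  level-norm (zero , _) = refl
  level-norm (suc l , _) = refl

  norm-norm : ∀ x → norm (norm x) ≡ norm x
  norm-norm (zero , _) = refl
  norm-norm (suc l , a , b) = cong (λ c → suc l , c , b) (absorb (does (l Finₚ.≟ fromℕ n′)))
    where
    absorb : ∀ p → (if p then b else (if p then b else a)) ≡ (if p then b else a)
    absorb true = refl
    absorb false = refl

  norm-finish : ∀ a b → norm (fromℕ n , a , b) ≡ (fromℕ n , b , b)
  norm-finish a b rewrite dec-true (fromℕ n′ Finₚ.≟ fromℕ n′) refl = refl

  norm-first : ∀ x → ¬ level x ≡ fromℕ n → proj₁ (proj₂ (norm x)) ≡ proj₁ (proj₂ x)
  norm-first (zero , _) _ = refl
  norm-first (suc l , _) l≢n with l Finₚ.≟ fromℕ n′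
  ... | yes eq = ⊥-elim (l≢n (cong suc eq))
  ... | no _ = refl

  norm-second : ∀ x → ¬ level x ≡ zero → proj₂ (proj₂ (norm x)) ≡ proj₂ (proj₂ x)
  norm-second (zero , _) ne = ⊥-elim (ne refl)
  norm-second (suc l , _) _ = refl

  norm≡⇒pinchEq : ∀ x y → norm x ≡ norm y → pinchEq n A x y
  norm≡⇒pinchEq (zero , a , b) (zero , .a , b′) refl = inj₂ (inj₁ (refl , refl , refl))
  norm≡⇒pinchEq (zero , a , b) (suc _ , _) ()
  norm≡⇒pinchEq (suc _ , _) (zero , _) ()
  norm≡⇒pinchEq (suc l , a , b) (suc l′ , a′ , b′) eq with cong proj₁ eq
  ... | refl with l Finₚ.≟ fromℕ n′
  ...   | yes p = inj₂ (inj₂ (cong suc p , cong suc p , cong (proj₂ ∘ proj₂) eq))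
  ...   | no _ = inj₁ eq

  pinchEq⇒norm≡ : ∀ x y → pinchEq n A x y → norm x ≡ norm y
  pinchEq⇒norm≡ x .x (inj₁ refl) = refl
  pinchEq⇒norm≡ _ _ (inj₂ (inj₁ (refl , refl , refl))) = refl
  pinchEq⇒norm≡ (_ , a , b) (_ , a′ , b′) (inj₂ (inj₂ (refl , refl , refl))) =
    trans (norm-finish a b) (sym (norm-finish a′ b′))

  PointRel : (i : Fin (m σ)) → Vec Point (arity σ i) → Set
  PointRel i t = Σ (Vec Point (arity σ i)) λ s →
    (rel (pinchProduct n A) i s ≡ true) × (map norm s ≡ t)

  abstract
    PointRel? : ∀ i → Decidable (PointRel i)
    PointRel? i t = vec-any? finite-Point λ s →
      (rel (pinchProduct n A) i s Boolₚ.≟ true) ×-dec Vecₚ.≡-dec _≟ₚ_ (map norm s) t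

  -- A family of k components, each a pinch whose start (level 0) and finish (level n)
  -- may be missing; hs and hf say where they are present.
  -- Classes of pinchEq are represented by their normal forms.
  module Family {k : ℕ} (hs hf : Fin k → Bool) where

    Valid : Fin k × Point → Set
    Valid (c , x) = (norm x ≡ x) × (level x ≡ zero → hs c ≡ true) × (level x ≡ fromℕ n → hf c ≡ true)

    abstract
      Valid? : Decidable Valid
      Valid? (c , x) = (norm x ≟ₚ x)
        ×-dec ((level x Finₚ.≟ zero) →-dec (hs c Boolₚ.≟ true))
        ×-dec ((level x Finₚ.≟ fromℕ n) →-dec (hf c Boolₚ.≟ true))

    Vertex : Set
    Vertex = Σ (Fin k × Point) (T ∘ does ∘ Valid?)

    comp : Vertex → Fin k
    comp = proj₁ ∘ proj₁

    point : Vertex → Point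
    point = proj₂ ∘ proj₁

    valid : (v : Vertex) → Valid (proj₁ v)
    valid (u , t) = Equivalence.to (does⇔ (Valid? u)) (Equivalence.to T-≡ t)

    vertex : ∀ c x → Valid (c , x) → Vertex
    vertex c x v = (c , x) , Equivalence.from T-≡ (dec-true (Valid? (c , x)) v)

    SameComp : ∀ {r} → Vec Vertex r → Set
    SameComp t = Σ (Fin k) λ c → ∀ j → comp (lookup t j) ≡ c

    FamRel : (i : Fin (m σ)) → Vec Vertex (arity σ i) → Set
    FamRel i t = SameComp t × PointRel i (map point t)

    abstract
      FamRel? : ∀ i → Decidable (FamRel i)
      FamRel? i t = Finₚ.any? (λ c → Finₚ.all? (λ j → comp (lookup t j) Finₚ.≟ c))
        ×-dec PointRel? i (map point t)

    Fam : Structure σ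
    Fam = record
      { pre = record { Carrier = Vertex ; rel = λ i t → does (FamRel? i t) }
      ; size = proj₁ F ; enum = proj₂ F }
      where
      F = subset-finite (finite-Fin k ×-finite finite-Point) (does ∘ Valid?)

    Fam-rel : ∀ i t → Rel Fam i t ≡ true ⇔ FamRel i t
    Fam-rel i t = does⇔ (FamRel? i t)

    -- A component with its start only has no level at which the first coordinate is forgotten, so
    -- the first projection is well defined on it; with its finish only, the second projection is.
    -- Both preserve relations because the product relations hold coordinatewise.
    hom-half : (∀ c → hf c ≡ not (hs c)) → HomTo Fam A
    hom-half half = f , f-hom
      where
      f : Vertex → ∣ A ∣
      f ((c , _ , a , b) , _) = if hs c then a else b
      f-hom : IsHom Fam A f
      f-hom i t t∈ with Equivalence.to (Fam-rel i t) t∈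
      ... | (c , same) , s , s∈ , eq = subst (λ s′ → Rel A i s′ ≡ true) coords (side (hs c))
        where
        coordinates-rel : ∀ x {y z : Bool} → x ∧ y ∧ z ≡ true → (y ≡ true) × (z ≡ true)
        coordinates-rel true {true} {true} _ = refl , refl
        choose : Bool → Point → ∣ A ∣
        choose h (_ , a , b) = if h then a else b
        side : ∀ h → Rel A i (map (choose h) s) ≡ true
        side true = proj₁ (coordinates-rel (linkRel n (arity σ i) (map proj₁ s)) s∈)
        side false = proj₂ (coordinates-rel (linkRel n (arity σ i) (map proj₁ s)) s∈)
        pointwise : ∀ j → norm (lookup s j) ≡ point (lookup t j)
        pointwise j = trans (sym (Vecₚ.lookup-map j norm s))
          (trans (cong (λ v → lookup v j) eq) (Vecₚ.lookup-map j point t))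
        -- No representative `x` of a present class lies at the missing end, and elsewhere `norm`
        -- keeps the chosen coordinate.
        coord : ∀ (v : Vertex) x → norm x ≡ point v → choose (hs (comp v)) x ≡ f v
        coord v x eq with hs (comp v) in hsc | valid v
        ... | true | _ , _ , fin = trans (sym (norm-first x λ l≡n →
              true≢false (trans (sym (fin (trans (cong level (sym eq)) (trans (level-norm x) l≡n))))
                (trans (half _) (cong not hsc))))) (cong (proj₁ ∘ proj₂) eq)
          where
          true≢false : true ≡ false → ⊥
          true≢false ()
        ... | false | _ , st , _ = trans (sym (norm-second x λ l≡0 →
              false≢true (st (trans (cong level (sym eq)) (trans (level-norm x) l≡0)))))
              (cong (proj₂ ∘ proj₂) eq)
          where
          false≢true : false ≡ true → ⊥
          false≢true ()
        coords : map (choose (hs c)) s ≡ map f t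
        coords = lookup-ext λ j → trans (Vecₚ.lookup-map j (choose (hs c)) s)
          (trans (subst (λ c′ → choose (hs c′) (lookup s j) ≡ f (lookup t j)) (same j)
            (coord (lookup t j) (lookup s j) (pointwise j)))
          (sym (Vecₚ.lookup-map j f t)))

  open Family using (Fam)

  data Kind : Set where
    whole left right : Kind

  hasStart hasFinish : Kind → Bool
  hasStart right = false
  hasStart _ = true
  hasFinish left = false
  hasFinish _ = true

  FamOf : ∀ {k} → (Fin k → Kind) → Structure σ
  FamOf ty = Fam (hasStart ∘ ty) (hasFinish ∘ ty)

  module Closed (K : Structure σ → Set) (pinchClosed : PinchClosed K A)
                (unionClosed : DisjointUnionClosed K) where

    One : Kind → Structure σ
    One κ = FamOf {1} (λ _ → κ)

    module F κ = Family {1} (λ _ → hasStart κ) (λ _ → hasFinish κ)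

    q : Point → ∣ One whole ∣
    q x = F.vertex whole zero (norm x) (norm-norm x , (λ _ → refl) , (λ _ → refl))

    one-comp : ∀ κ {r} (t : Vec ∣ One κ ∣ r) → F.SameComp κ t
    one-comp κ t = zero , λ j → unique (F.comp κ (lookup t j))
      where
      unique : (c : Fin 1) → c ≡ zero
      unique zero = refl

    F-≡ : ∀ κ {u v : ∣ One κ ∣} → F.point κ u ≡ F.point κ v → u ≡ v
    F-≡ κ {(zero , _) , _} {(zero , _) , _} refl = Σ-T-≡ refl

    q-quotient : IsQuotientMap (pinchProduct n A) (pinchEq n A) (One whole) q
    q-quotient = record
      { surjective = λ y → F.point whole y , F-≡ whole (proj₁ (F.valid whole y))
      ; kernel = λ x y → mk⇔
          (λ eq → norm≡⇒pinchEq x y (cong (F.point whole) eq))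
          (λ eq → F-≡ whole (pinchEq⇒norm≡ x y eq))
      ; relations = λ i t → mk⇔
          (λ t∈ → let (_ , s , s∈ , eq) = Equivalence.to (F.Fam-rel whole i t) t∈ in
            s , s∈ , lookup-ext λ j → trans (Vecₚ.lookup-map j q s) (F-≡ whole
              (trans (sym (Vecₚ.lookup-map j norm s))
              (trans (cong (λ v → lookup v j) eq) (Vecₚ.lookup-map j (F.point whole) t)))))
          (λ { (s , s∈ , refl) → Equivalence.from (F.Fam-rel whole i t)
            (one-comp whole t , s , s∈ , Vecₚ.map-∘ (F.point whole) q s) })
      }

    -- One argument serves both half pinches: the relations of a family look at components and
    -- points alone, so removing an end does not affect the tuples that remain.
    induced : ∀ κ (S : ∣ One whole ∣ → Set) →
      (∀ y → S y → F.Valid κ (proj₁ y)) →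
      (∀ y (x : ∣ One κ ∣) → F.point κ x ≡ F.point whole y → S y) →
      IsInducedSubstructure (One κ) (One whole) S
    induced κ S S⇒valid valid⇒S = record
      { emb = emb
      ; injective = λ x y eq → F-≡ κ (cong (F.point whole) eq)
      ; image = λ y → mk⇔
          (λ Sy → F.vertex κ (F.comp whole y) (F.point whole y) (S⇒valid y Sy) , F-≡ whole refl)
          (λ { (x , refl) → valid⇒S (emb x) x refl })
      ; relations = λ i t → does-cong (F.FamRel? κ i t) (F.FamRel? whole i (map emb t)) (mk⇔
          (λ (_ , p) → one-comp whole (map emb t) , subst (PointRel i) (Vecₚ.map-∘ (F.point whole) emb t) p)
          (λ (_ , p) → one-comp κ t , subst (PointRel i) (sym (Vecₚ.map-∘ (F.point whole) emb t)) p))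
      }
      where
      emb : ∣ One κ ∣ → ∣ One whole ∣
      emb x = F.vertex whole (F.comp κ x) (F.point κ x) (proj₁ (F.valid κ x) , (λ _ → refl) , (λ _ → refl))

    level-q : ∀ x y → q x ≡ y → level (F.point whole y) ≡ level x
    level-q x y eq = trans (cong (level ∘ F.point whole) (sym eq)) (level-norm x)

    pinch-K : K (One whole) × K (One right) × K (One left)
    pinch-K with pinchClosed n (s≤s z≤n) (One whole) q q-quotient
    -- The first induced substructure omits level 0 and so lacks its start; the second omits level
    -- `n`. Since `norm` keeps levels, all representatives of a class agree on whether they lie at
    -- an end.
    ... | w , r , l = w
      , r (One right) (induced right _
          (λ y (x , eq , ne) → proj₁ (F.valid whole y)
            , (λ l≡0 → ⊥-elim (ne (trans (sym (level-q x y eq)) l≡0))) , λ _ → refl)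
          λ y x eq → F.point whole y , F-≡ whole (proj₁ (F.valid whole y))
            , λ l≡0 → case-false (proj₁ (proj₂ (F.valid right x)) (trans (cong level eq) l≡0)))
      , l (One left) (induced left _
          (λ y (x , eq , ne) → proj₁ (F.valid whole y) , (λ _ → refl)
            , (λ l≡n → ⊥-elim (ne (trans (sym (level-q x y eq)) l≡n))))
          λ y x eq → F.point whole y , F-≡ whole (proj₁ (F.valid whole y))
            , λ l≡n → case-false (proj₂ (proj₂ (F.valid left x)) (trans (cong level eq) l≡n)))
      where
      case-false : false ≡ true → ⊥
      case-false ()

    one-K : ∀ κ → K (One κ)
    one-K whole = proj₁ pinch-K
    one-K right = proj₁ (proj₂ pinch-K)
    one-K left = proj₂ (proj₂ pinch-K)

    fam-union : ∀ {k} κ (ty : Fin k → Kind) →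
      IsDisjointUnion (FamOf (extend κ ty)) (One κ) (FamOf ty)
    fam-union {k} κ ty = record
      { inl = inl ; inr = inr
      ; inl-inj = λ x y eq → F-≡ κ (cong D.point eq)
      ; inr-inj = λ { ((c , x) , _) ((c′ , x′) , _) eq → Σ-T-≡ (cong₂ _,_
          (Finₚ.suc-injective (cong D.comp eq)) (cong D.point eq)) }
      ; disjoint = λ x y eq → zero≢suc (cong D.comp eq)
      ; cover = cover
      ; relations = λ i t → mk⇔
          (λ t∈ → split i t (Equivalence.to (D.Fam-rel i t) t∈))
          λ { (inj₁ (s , s∈ , refl)) → Equivalence.from (D.Fam-rel i t)
                ( (zero , λ j → cong D.comp (Vecₚ.lookup-map j inl s))
                , subst (PointRel i) (Vecₚ.map-∘ D.point inl s)
                    (proj₂ (Equivalence.to (F.Fam-rel κ i s) s∈)))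
            ; (inj₂ (s , s∈ , refl)) → Equivalence.from (D.Fam-rel i t)
                (let ((c , same) , p) = Equivalence.to (C.Fam-rel i s) s∈ in
                  (suc c , λ j → trans (cong D.comp (Vecₚ.lookup-map j inr s)) (cong suc (same j)))
                , subst (PointRel i) (Vecₚ.map-∘ D.point inr s) p) }
      }
      where
      module D = Family (hasStart ∘ extend κ ty) (hasFinish ∘ extend κ ty)
      module C = Family (hasStart ∘ ty) (hasFinish ∘ ty)
      zero≢suc : ∀ {c : Fin k} → zero ≡ suc c → ⊥
      zero≢suc ()
      inl : ∣ One κ ∣ → D.Vertex
      inl x = D.vertex zero (F.point κ x) (F.valid κ x)
      inr : C.Vertex → D.Vertex
      inr y = D.vertex (suc (C.comp y)) (C.point y) (C.valid y)
      from-zero : ∀ z → D.comp z ≡ zero → Σ ∣ One κ ∣ λ x → inl x ≡ z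
      from-zero z@((.zero , x) , _) refl = F.vertex κ zero x (D.valid z) , Σ-T-≡ refl
      from-suc : ∀ z c → D.comp z ≡ suc c → Σ C.Vertex λ y → inr y ≡ z
      from-suc z@((.(suc c) , x) , _) c refl = C.vertex c x (D.valid z) , Σ-T-≡ refl
      cover : ∀ z → (Σ ∣ One κ ∣ λ x → inl x ≡ z) ⊎ (Σ C.Vertex λ y → inr y ≡ z)
      cover z with D.comp z in eq
      ... | zero = inj₁ (from-zero z eq)
      ... | suc c = inj₂ (from-suc z c eq)
      split : ∀ i t → D.FamRel i t → _ ⊎ _
      split i t ((zero , same) , p) with map-preimage inl t (λ j → from-zero (lookup t j) (same j))
      ... | s , refl = inj₁ (s , Equivalence.from (F.Fam-rel κ i s)
            (one-comp κ s , subst (PointRel i) (sym (Vecₚ.map-∘ D.point inl s)) p) , refl)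
      split i t ((suc c , same) , p) with map-preimage inr t (λ j → from-suc (lookup t j) c (same j))
      ... | s , refl = inj₂ (s , Equivalence.from (C.Fam-rel i s)
            ( (c , λ j → Finₚ.suc-injective (trans (cong D.comp (sym (Vecₚ.lookup-map j inr s))) (same j)))
            , subst (PointRel i) (sym (Vecₚ.map-∘ D.point inr s)) p) , refl)

    -- Components are added one at a time, beginning with one because `K` need not contain the empty
    -- structure. The union produces a labelling built with `extend`, which agrees with `ty`
    -- pointwise but not definitionally; hence the existential form.
    fam-K : ∀ {k} (ty : Fin (suc k) → Kind) →
      Σ (Fin (suc k) → Kind) λ ty′ → (∀ c → ty′ c ≡ ty c) × K (FamOf ty′)
    fam-K {zero} ty = (λ _ → ty zero) , (λ { zero → refl }) , one-K (ty zero)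
    fam-K {suc k} ty with fam-K (ty ∘ suc)
    ... | ty′ , eq , k′ = extend (ty zero) ty′ , (λ { zero → refl ; (suc c) → eq c }) ,
      unionClosed _ _ _ (one-K (ty zero)) k′ (fam-union (ty zero) ty′)

-- The link relation and the distance between levels

anyFin⇔ : ∀ n p → anyFin n p ≡ true ⇔ Σ (Fin n) λ e → p e ≡ true
anyFin⇔ n p = mk⇔ (to n p) (from n p)
  where
  to : ∀ n p → anyFin n p ≡ true → Σ (Fin n) λ e → p e ≡ true
  to (suc n) p eq with p zero in p0
  ... | true = zero , p0
  ... | false with to n (p ∘ suc) eq
  ...   | e , pe = suc e , pe
  from : ∀ n p → (Σ (Fin n) λ e → p e ≡ true) → anyFin n p ≡ true
  from (suc n) p (zero , pe) rewrite pe = refl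
  from (suc n) p (suc e , pe) rewrite from n (p ∘ suc) (e , pe) = Boolₚ.∨-zeroʳ (p zero)

allVec⇔ : ∀ {X : Set} {k} (p : X → Bool) (t : Vec X k) →
  allVec p t ≡ true ⇔ (∀ j → p (lookup t j) ≡ true)
allVec⇔ p t = mk⇔ (to t) (from t)
  where
  to : ∀ {k} (t : Vec _ k) → allVec p t ≡ true → ∀ j → p (lookup t j) ≡ true
  to (x ∷ t) eq j with p x in px
  to (x ∷ t) eq zero | true = px
  to (x ∷ t) eq (suc j) | true = to t eq j
  from : ∀ {k} (t : Vec _ k) → (∀ j → p (lookup t j) ≡ true) → allVec p t ≡ true
  from [] _ = refl
  from (x ∷ t) h rewrite h zero = from t (h ∘ suc)

≡ᵇ⇔ : ∀ x y → (x ≡ᵇ y) ≡ true ⇔ x ≡ y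
≡ᵇ⇔ x y = mk⇔ (λ eq → ℕₚ.≡ᵇ⇒≡ x y (Equivalence.from T-≡ eq))
             (λ eq → Equivalence.to T-≡ (ℕₚ.≡⇒≡ᵇ x y eq))

inEdge⇔ : ∀ {n} (e : Fin n) x → inEdge e x ≡ true ⇔ (toℕ x ≡ toℕ e ⊎ toℕ x ≡ suc (toℕ e))
inEdge⇔ e x = mk⇔ to from
  where
  to : inEdge e x ≡ true → _
  to eq with toℕ x ≡ᵇ toℕ e in eqe
  ... | true = inj₁ (Equivalence.to (≡ᵇ⇔ _ _) eqe)
  ... | false = inj₂ (Equivalence.to (≡ᵇ⇔ _ _) eq)
  from : (toℕ x ≡ toℕ e ⊎ toℕ x ≡ suc (toℕ e)) → inEdge e x ≡ true
  from (inj₁ eq) rewrite Equivalence.from (≡ᵇ⇔ (toℕ x) (toℕ e)) eq = refl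
  from (inj₂ eq) rewrite Equivalence.from (≡ᵇ⇔ (toℕ x) (suc (toℕ e))) eq = Boolₚ.∨-zeroʳ _

linkRel⇔ : ∀ n {k} (t : Vec (Fin (suc n)) k) → linkRel n k t ≡ true ⇔
  Σ (Fin n) λ e → ∀ j → toℕ (lookup t j) ≡ toℕ e ⊎ toℕ (lookup t j) ≡ suc (toℕ e)
linkRel⇔ n t = mk⇔
  (λ eq → let (e , all) = Equivalence.to (anyFin⇔ n _) eq in
    e , λ j → Equivalence.to (inEdge⇔ e _) (Equivalence.to (allVec⇔ (inEdge e) t) all j))
  (λ (e , h) → Equivalence.from (anyFin⇔ n _)
    (e , Equivalence.from (allVec⇔ (inEdge e) t) λ j → Equivalence.from (inEdge⇔ e _) (h j)))

∧-true : ∀ {x y} → x ∧ y ≡ true → (x ≡ true) × (y ≡ true)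
∧-true {true} {true} _ = refl , refl

Near : ∀ {n} → ℕ → Fin n → Fin n → Set
Near d x y = (toℕ x ≤ toℕ y + d) × (toℕ y ≤ toℕ x + d)

Near? : ∀ {n} d (x y : Fin n) → Dec (Near d x y)
Near? d x y = (toℕ x ℕₚ.≤? toℕ y + d) ×-dec (toℕ y ℕₚ.≤? toℕ x + d)

Near-sym : ∀ {n} d {x y : Fin n} → Near d x y → Near d y x
Near-sym d (p , q) = q , p

Near-refl : ∀ {n} d (x : Fin n) → Near d x x
Near-refl d x = ℕₚ.m≤m+n _ d , ℕₚ.m≤m+n _ d

Near-trans : ∀ {n} d d′ {x y z : Fin n} → Near d x y → Near d′ y z → Near (d + d′) x z
Near-trans d d′ {x} {y} {z} (p , q) (p′ , q′) = one , two
  where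
  open ℕₚ.≤-Reasoning
  one : toℕ x ≤ toℕ z + (d + d′)
  one = begin
    toℕ x            ≤⟨ p ⟩
    toℕ y + d        ≤⟨ ℕₚ.+-monoˡ-≤ d p′ ⟩
    toℕ z + d′ + d   ≡⟨ trans (ℕₚ.+-assoc (toℕ z) d′ d) (cong (toℕ z +_) (ℕₚ.+-comm d′ d)) ⟩
    toℕ z + (d + d′) ∎
  two : toℕ z ≤ toℕ x + (d + d′)
  two = begin
    toℕ z            ≤⟨ q′ ⟩
    toℕ y + d′       ≤⟨ ℕₚ.+-monoˡ-≤ d′ q ⟩
    toℕ x + d + d′   ≡⟨ ℕₚ.+-assoc (toℕ x) d d′ ⟩
    toℕ x + (d + d′) ∎

Near-mono : ∀ {n} {d d′} {x y : Fin n} → d ≤ d′ → Near d x y → Near d′ x y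
Near-mono d≤d′ (p , q) = ℕₚ.≤-trans p (ℕₚ.+-monoʳ-≤ _ d≤d′) , ℕₚ.≤-trans q (ℕₚ.+-monoʳ-≤ _ d≤d′)

-- All levels in a related tuple lie on one edge of the link; this locality lets pebbles that are
-- far apart be treated independently.
linkRel⇒Near : ∀ n {k} (t : Vec (Fin (suc n)) k) → linkRel n k t ≡ true →
  ∀ i j → Near 1 (lookup t i) (lookup t j)
linkRel⇒Near n t t∈ i j with Equivalence.to (linkRel⇔ n t) t∈
... | e , h = bound (h i) (h j) , bound (h j) (h i)
  where
  bound : ∀ {a b e} → a ≡ e ⊎ a ≡ suc e → b ≡ e ⊎ b ≡ suc e → a ≤ b + 1
  bound {e = e} (inj₁ refl) (inj₁ refl) = ℕₚ.m≤m+n e 1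
  bound {e = e} (inj₁ refl) (inj₂ refl) = ℕₚ.≤-trans (ℕₚ.n≤1+n e) (ℕₚ.m≤m+n (suc e) 1)
  bound {e = e} (inj₂ refl) (inj₁ refl) = ℕₚ.≤-reflexive (ℕₚ.+-comm 1 e)
  bound {e = e} (inj₂ refl) (inj₂ refl) = ℕₚ.m≤m+n (suc e) 1

-- The Ehrenfeucht–Fraïssé game

quantifierRank : ∀ {σ n} → Formula σ n → ℕ
quantifierRank (relᶠ _ _) = 0
quantifierRank (_ ≐ _) = 0
quantifierRank ⊤ᶠ = 0
quantifierRank ⊥ᶠ = 0
quantifierRank (¬ᶠ φ) = quantifierRank φ
quantifierRank (φ ∧ᶠ ψ) = quantifierRank φ ⊔ quantifierRank ψ
quantifierRank (φ ∨ᶠ ψ) = quantifierRank φ ⊔ quantifierRank ψ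
quantifierRank (∃ᶠ φ) = suc (quantifierRank φ)
quantifierRank (∀ᶠ φ) = suc (quantifierRank φ)

-- The number 2^r, built by doubling to match the halving of the radius in each round of the game.
reach : ℕ → ℕ
reach zero = 1
reach (suc r) = reach r + reach r

reach-≥1 : ∀ r → 1 ≤ reach r
reach-≥1 zero = s≤s z≤n
reach-≥1 (suc r) = ℕₚ.≤-trans (reach-≥1 r) (ℕₚ.m≤m+n _ _)

-- Duplicator always answers with the same point, possibly in another component. With r rounds
-- to go, pebbles at level distance at most 2^r must agree on lying in a common component, and a
-- pebble within 2^r of an end must agree on whether its component has that end.
module Game {σ : Signature} (A : Structure σ) (n′ : ℕ) (arity≥1 : (i : Fin (m σ)) → 1 ≤ arity σ i) where

  open Pinch A n′

  record Board : Set where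
    field
      components : ℕ
      hs hf : Fin components → Bool
    open Family hs hf public

  open Board

  -- A reserve of components with exactly one end, of both kinds, that up to `M` pebbles cannot
  -- exhaust.
  Fresh : Board → ℕ → Set
  Fresh β M = ∀ {p} → p ≤ M → (f : Fin p → Fin (components β)) → ∀ h →
    Σ (Fin (components β)) λ c → (hs β c ≡ h) × (hf β c ≡ not h) × (∀ i → ¬ f i ≡ c)

  lev : (β : Board) → Vertex β → Fin (suc n)
  lev β v = level (point β v)

  record Position (d : ℕ) (β γ : Board) {p} (ρ : Fin p → Vertex β) (τ : Fin p → Vertex γ) : Set where
    field
      same : ∀ i → point β (ρ i) ≡ point γ (τ i)
      together : ∀ i j → Near d (lev β (ρ i)) (lev β (ρ j)) →
        comp β (ρ i) ≡ comp β (ρ j) ⇔ comp γ (τ i) ≡ comp γ (τ j)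
      start : ∀ i → toℕ (lev β (ρ i)) ≤ d → hs β (comp β (ρ i)) ≡ hs γ (comp γ (τ i))
      finish : ∀ i → n ≤ toℕ (lev β (ρ i)) + d → hf β (comp β (ρ i)) ≡ hf γ (comp γ (τ i))

  open Position

  Position-sym : ∀ {d β γ p} {ρ : Fin p → Vertex β} {τ : Fin p → Vertex γ} →
    Position d β γ ρ τ → Position d γ β τ ρ
  Position-sym {d} {β} {γ} {ρ = ρ} {τ} P = record
    { same = λ i → sym (same P i)
    ; together = λ i j nr →
        let e = together P i j (subst (λ x → Near d x (lev β (ρ j))) (sl i) (subst (Near d _) (sl j) nr)) in
        mk⇔ (Equivalence.from e) (Equivalence.to e)
    ; start = λ i l≤d → sym (start P i (subst (λ x → toℕ x ≤ d) (sl i) l≤d))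
    ; finish = λ i n≤ → sym (finish P i (subst (λ x → n ≤ toℕ x + d) (sl i) n≤))
    }
    where
    sl : ∀ i → lev γ (τ i) ≡ lev β (ρ i)
    sl i = cong level (sym (same P i))

  respond : ∀ {d β γ p M} {ρ : Fin p → Vertex β} {τ : Fin p → Vertex γ} →
    d + d < n → p ≤ M → Fresh γ M → Position (d + d) β γ ρ τ →
    (v : Vertex β) → Σ (Vertex γ) λ w → Position d β γ (extend v ρ) (extend w τ)
  respond {d} {β} {γ} {p} {ρ = ρ} {τ} 2d<n p≤M fresh P v = w , P′
    where
    x : Point
    x = point β v
    c : Fin (components β)
    c = comp β v

    Answer : Fin (components γ) → Set
    Answer c′ = (toℕ (level x) ≤ d → hs β c ≡ hs γ c′)
      × (n ≤ toℕ (level x) + d → hf β c ≡ hf γ c′)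
      × (∀ i → Near d (level x) (lev β (ρ i)) → c ≡ comp β (ρ i) ⇔ c′ ≡ comp γ (τ i))

    neighbour? : Dec (Σ (Fin p) λ i → Near d (level x) (lev β (ρ i)) × c ≡ comp β (ρ i))
    neighbour? = Finₚ.any? λ i → Near? d (level x) (lev β (ρ i)) ×-dec (c Finₚ.≟ comp β (ρ i))

    new : (∀ i → Near d (level x) (lev β (ρ i)) → ¬ c ≡ comp β (ρ i)) →
      ∀ h → (toℕ (level x) ≤ d → hs β c ≡ h) → (n ≤ toℕ (level x) + d → hf β c ≡ not h) →
      Σ (Fin (components γ)) Answer
    new ¬nb h st fin with fresh p≤M (comp γ ∘ τ) h
    ... | c′ , hs≡ , hf≡ , avoid = c′ , (λ le → trans (st le) (sym hs≡)) , (λ le → trans (fin le) (sym hf≡)) ,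
      λ i nr → mk⇔ (λ eq → ⊥-elim (¬nb i nr eq)) (λ eq → ⊥-elim (avoid i (sym eq)))

    answer : Σ (Fin (components γ)) Answer
    answer with neighbour?
    ... | yes (j , nr , refl) = comp γ (τ j)
      , (λ le → start P j (ℕₚ.≤-trans (proj₂ nr) (ℕₚ.+-monoˡ-≤ d le)))
      , (λ le → finish P j (ℕₚ.≤-trans le (ℕₚ.≤-trans (ℕₚ.+-monoˡ-≤ d (proj₁ nr))
          (ℕₚ.≤-reflexive (ℕₚ.+-assoc _ d d)))))
      , λ i nr′ → together P j i (Near-trans d d {y = level x} (Near-sym d {level x} nr) nr′)
    -- Near the start, the start is copied. Otherwise only the finish can be visible, so `h` is the
    -- negated finish, making `not h` agree with it.
    ... | no ¬nb with toℕ (level x) ℕₚ.≤? d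
    ...   | yes le = new (λ i nr eq → ¬nb (i , nr , eq)) (hs β c) (λ _ → refl)
            λ n≤ → ⊥-elim (ℕₚ.<⇒≱ 2d<n (ℕₚ.≤-trans n≤ (ℕₚ.+-monoˡ-≤ d le)))
    ...   | no ¬le = new (λ i nr eq → ¬nb (i , nr , eq)) (not (hf β c)) (λ le → ⊥-elim (¬le le))
            λ _ → sym (Boolₚ.not-involutive _)

    c′ : Fin (components γ)
    c′ = proj₁ answer

    w : Vertex γ
    w = vertex γ c′ x (let (nm , st , fin) = valid β v ; (a , b , _) = proj₂ answer in
        nm
      , (λ l≡0 → trans (sym (a (subst (λ l → toℕ l ≤ d) (sym l≡0) z≤n))) (st l≡0))
      , (λ l≡n → trans (sym (b (subst (λ l → n ≤ toℕ l + d) (sym l≡n)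
          (ℕₚ.≤-trans (ℕₚ.≤-reflexive (sym (Finₚ.toℕ-fromℕ n))) (ℕₚ.m≤m+n _ d))))) (fin l≡n)))

    P′ : Position d β γ (extend v ρ) (extend w τ)
    P′ = record
      { same = λ { zero → refl ; (suc i) → same P i }
      ; together = tog
      ; start = λ { zero → proj₁ (proj₂ answer)
                  ; (suc i) le → start P i (ℕₚ.≤-trans le (ℕₚ.m≤m+n d d)) }
      ; finish = λ { zero → proj₁ (proj₂ (proj₂ answer))
                   ; (suc i) le → finish P i (ℕₚ.≤-trans le (ℕₚ.+-monoʳ-≤ _ (ℕₚ.m≤m+n d d))) }
      }
      where
      tog : ∀ i j → Near d (lev β (extend v ρ i)) (lev β (extend v ρ j)) →
        comp β (extend v ρ i) ≡ comp β (extend v ρ j) ⇔ comp γ (extend w τ i) ≡ comp γ (extend w τ j)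
      tog zero zero _ = mk⇔ (λ _ → refl) (λ _ → refl)
      tog zero (suc j) nr = proj₂ (proj₂ (proj₂ answer)) j nr
      tog (suc i) zero nr = let e = proj₂ (proj₂ (proj₂ answer)) i (Near-sym d {lev β (ρ i)} nr) in
        mk⇔ (sym ∘ Equivalence.to e ∘ sym) (sym ∘ Equivalence.from e ∘ sym)
      tog (suc i) (suc j) nr = together P i j (Near-mono {x = lev β (ρ i)} (ℕₚ.m≤m+n d d) nr)

  -- The representatives `s` carry over unchanged; what remains is to find a common component. Every
  -- entry is within distance 1 of the first, which exists as arities are positive, so `together`
  -- moves the equality across.
  atom-rel : ∀ {d β γ p} {ρ : Fin p → Vertex β} {τ : Fin p → Vertex γ} → 1 ≤ d → Position d β γ ρ τ →
    ∀ i (xs : Vec (Fin p) (arity σ i)) → FamRel β i (map ρ xs) → FamRel γ i (map τ xs)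
  atom-rel {d} {β} {γ} {ρ = ρ} {τ} 1≤d P i xs ((c , comps) , s , s∈ , eq) =
      (comp γ (τ (lookup xs first)) , λ j → trans (cong (comp γ) (Vecₚ.lookup-map j τ xs))
        (Equivalence.to (together P (lookup xs j) (lookup xs first)
            (Near-mono {x = lev β (ρ (lookup xs j))} 1≤d
              (subst (λ l → Near 1 l _) (levels j) (subst (Near 1 _) (levels first)
                (linkRel⇒Near n (map proj₁ s) (proj₁ (∧-true s∈)) j first)))))
          (trans (comp-at j) (sym (comp-at first)))))
    , s , s∈ , trans eq (trans (sym (Vecₚ.map-∘ (point β) ρ xs))
        (trans (Vecₚ.map-cong (same P) xs) (Vecₚ.map-∘ (point γ) τ xs)))
    where
    first : Fin (arity σ i)
    first = fromℕ< (arity≥1 i)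
    comp-at : ∀ j → comp β (ρ (lookup xs j)) ≡ c
    comp-at j = trans (cong (comp β) (sym (Vecₚ.lookup-map j ρ xs))) (comps j)
    levels : ∀ j → lookup (map proj₁ s) j ≡ lev β (ρ (lookup xs j))
    levels j = begin
      lookup (map proj₁ s) j                   ≡⟨ Vecₚ.lookup-map j proj₁ s ⟩
      level (lookup s j)                       ≡⟨ sym (level-norm (lookup s j)) ⟩
      level (norm (lookup s j))                ≡⟨ cong level (sym (Vecₚ.lookup-map j norm s)) ⟩
      level (lookup (map norm s) j)            ≡⟨ cong (λ v → level (lookup v j)) eq ⟩
      level (lookup (map (point β) (map ρ xs)) j) ≡⟨ cong level (Vecₚ.lookup-map j (point β) (map ρ xs)) ⟩
      lev β (lookup (map ρ xs) j)              ≡⟨ cong (lev β) (Vecₚ.lookup-map j ρ xs) ⟩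
      lev β (ρ (lookup xs j))                  ∎
      where open ≡-Reasoning

  -- Negation and universal quantification exchange the two boards, so both need a reserve. A round
  -- turns `suc r + p` into `r + suc p`, so rounds left plus pebbles placed stay within `M`.
  transfer : ∀ {M β γ} → Fresh β M → Fresh γ M → ∀ r {p} (φ : Formula σ p) {ρ τ} →
    quantifierRank φ ≤ r → reach r < n → r + p ≤ M → Position (reach r) β γ ρ τ →
    ⟦ φ ⟧ (Fam β) ρ → ⟦ φ ⟧ (Fam γ) τ
  transfer {β = β} {γ} fβ fγ r (relᶠ i xs) _ _ _ P h =
    Equivalence.from (Fam-rel γ i _) (atom-rel {β = β} {γ} (reach-≥1 r) P i xs (Equivalence.to (Fam-rel β i _) h))
  transfer {β = β} {γ} fβ fγ r (x ≐ y) {ρ} _ _ _ P eq = Σ-T-≡ (cong₂ _,_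
    (Equivalence.to (together P x y (subst (λ v → Near (reach r) (lev β (ρ x)) (lev β v)) eq (Near-refl _ _)))
      (cong (comp β) eq))
    (trans (sym (same P x)) (trans (cong (point β) eq) (same P y))))
  transfer fβ fγ r ⊤ᶠ _ _ _ _ h = h
  transfer fβ fγ r (¬ᶠ φ) qr rn M≥ P h = h ∘ transfer fγ fβ r φ qr rn M≥ (Position-sym P)
  transfer fβ fγ r (φ ∧ᶠ ψ) qr rn M≥ P (h , k) =
      transfer fβ fγ r φ (ℕₚ.m⊔n≤o⇒m≤o _ _ qr) rn M≥ P h
    , transfer fβ fγ r ψ (ℕₚ.m⊔n≤o⇒n≤o (quantifierRank φ) _ qr) rn M≥ P k
  transfer fβ fγ r (φ ∨ᶠ ψ) qr rn M≥ P (inj₁ h) =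
    inj₁ (transfer fβ fγ r φ (ℕₚ.m⊔n≤o⇒m≤o _ _ qr) rn M≥ P h)
  transfer fβ fγ r (φ ∨ᶠ ψ) qr rn M≥ P (inj₂ k) =
    inj₂ (transfer fβ fγ r ψ (ℕₚ.m⊔n≤o⇒n≤o (quantifierRank φ) _ qr) rn M≥ P k)
  transfer fβ fγ (suc r) {p} (∃ᶠ φ) (s≤s qr) rn M≥ P (v , h)
    with respond rn (ℕₚ.≤-trans (ℕₚ.m≤n+m p (suc r)) M≥) fγ P v
  ... | w , P′ = w , transfer fβ fγ r φ qr (ℕₚ.≤-<-trans (ℕₚ.m≤m+n _ _) rn)
    (ℕₚ.≤-trans (ℕₚ.≤-reflexive (ℕₚ.+-suc r p)) M≥) P′ h
  transfer fβ fγ (suc r) {p} (∀ᶠ φ) (s≤s qr) rn M≥ P h w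
    with respond rn (ℕₚ.≤-trans (ℕₚ.m≤n+m p (suc r)) M≥) fβ (Position-sym P) w
  ... | v , P′ = transfer fβ fγ r φ qr (ℕₚ.≤-<-trans (ℕₚ.m≤m+n _ _) rn)
    (ℕₚ.≤-trans (ℕₚ.≤-reflexive (ℕₚ.+-suc r p)) M≥) (Position-sym P′) (h v)

  -- Pigeonhole: were all `suc M` components of one kind occupied, choosing a pebble in each would
  -- inject them into `p` pebbles with `p ≤ M`.
  fresh : ∀ β M → (∀ h → Σ (Fin (suc M) → Fin (components β)) λ g →
      (∀ {i j} → g i ≡ g j → i ≡ j) × (∀ j → (hs β (g j) ≡ h) × (hf β (g j) ≡ not h))) →
    Fresh β M
  fresh β M supply {p} p≤M f h with supply h
  ... | g , inj , ends with Finₚ.any? (λ j → Finₚ.all? (λ i → ¬? (f i Finₚ.≟ g j)))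
  ...   | yes (j , avoid) = g j , proj₁ (ends j) , proj₂ (ends j) , avoid
  ...   | no ¬free = ⊥-elim (ℕₚ.<⇒≱ (s≤s p≤M) (Finₚ.injective⇒≤ {f = proj₁ ∘ used} λ {i} {j} eq →
            inj (trans (sym (proj₂ (used i))) (trans (cong f eq) (proj₂ (used j))))))
    where
    used : ∀ j → Σ (Fin p) λ i → f i ≡ g j
    used j = decidable-stable (Finₚ.any? λ i → f i Finₚ.≟ g j)
      λ ¬u → ¬free (j , λ i eq → ¬u (i , eq))

-- Chains of binary operations, obtained from whole pinches

record Chain {σ : Signature} (A : Structure σ) (n : ℕ) : Set where
  field
    G : ℕ → ∣ A ∣ → ∣ A ∣ → ∣ A ∣
    G-start : ∀ {a b b′} → G 0 a b ≡ G 0 a b′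
    G-finish : ∀ {a a′ b} → G n a b ≡ G n a′ b
    G-hom : ∀ {l} → l < n → ∀ i (ls : Fin (arity σ i) → ℕ) → (∀ j → ls j ≡ l ⊎ ls j ≡ suc l) →
      ∀ s s′ → Rel A i s ≡ true → Rel A i s′ ≡ true →
      Rel A i (tabulate λ j → G (ls j) (lookup s j) (lookup s′ j)) ≡ true

module _ {σ : Signature} (A : Structure σ) (n′ : ℕ) where
  open Pinch A n′

  private
    clamp : ℕ → Fin (suc n)
    clamp l = fromℕ< (s≤s (ℕₚ.m⊓n≤n l n))

    toℕ-clamp : ∀ {l} → l ≤ n → toℕ (clamp l) ≡ l
    toℕ-clamp {l} l≤n = trans (Finₚ.toℕ-fromℕ< _) (ℕₚ.m≤n⇒m⊓n≡m l≤n)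

  -- The restriction of `h` to a whole component is a homomorphism from the pinch, read level by
  -- level. The identifications at the two ends become `G-start` and `G-finish`; a tuple on one link
  -- edge, with entries at either of its levels, becomes the mixing in `G-hom`.
  whole-chain : ∀ {k} (ty : Fin k → Kind) c → ty c ≡ whole → HomTo (FamOf ty) A → Chain A n
  whole-chain ty c whole≡ (h , h-hom) = record
    { G = λ l a b → h (at (clamp l , a , b))
    ; G-start = cong h (Σ-T-≡ refl)
    ; G-finish = λ {a} {a′} {b} → cong h (Σ-T-≡ (cong (c ,_)
        (subst (λ l → norm (l , a , b) ≡ norm (l , a′ , b)) (sym clamp-n)
          (trans (norm-finish a b) (sym (norm-finish a′ b))))))
    ; G-hom = λ l<n i ls lsl s s′ s∈ s′∈ → subst (λ v → Rel A i v ≡ true)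
        (sym (Vecₚ.tabulate-∘ h _))
        (h-hom i _ (Equivalence.from (F.Fam-rel i _) (related l<n i ls lsl s s′ s∈ s′∈)))
    }
    where
    module F = Family (hasStart ∘ ty) (hasFinish ∘ ty)
    at : Point → ∣ FamOf ty ∣
    at x = F.vertex c (norm x) (norm-norm x , (λ _ → cong hasStart whole≡) , (λ _ → cong hasFinish whole≡))
    clamp-n : clamp n ≡ fromℕ n
    clamp-n = Finₚ.toℕ-injective (trans (toℕ-clamp ℕₚ.≤-refl) (sym (Finₚ.toℕ-fromℕ n)))
    related : ∀ {l} → l < n → ∀ i (ls : Fin (arity σ i) → ℕ) → (∀ j → ls j ≡ l ⊎ ls j ≡ suc l) →
      ∀ s s′ → Rel A i s ≡ true → Rel A i s′ ≡ true →
      F.FamRel i (tabulate λ j → at (clamp (ls j) , lookup s j , lookup s′ j))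
    related {l} l<n i ls lsl s s′ s∈ s′∈ =
        (c , λ j → cong F.comp (Vecₚ.lookup∘tabulate _ j))
      , tabulate x
      , conj (Equivalence.from (linkRel⇔ n (map proj₁ (tabulate x))) (fromℕ< l<n , λ j → edge j (lsl j)))
             (trans (cong (Rel A i) (coords (proj₁ ∘ proj₂) s λ j → refl)) s∈)
             (trans (cong (Rel A i) (coords (proj₂ ∘ proj₂) s′ λ j → refl)) s′∈)
      , trans (sym (Vecₚ.tabulate-∘ norm x)) (Vecₚ.tabulate-∘ F.point (at ∘ x))
      where
      x : Fin (arity σ i) → Point
      x j = clamp (ls j) , lookup s j , lookup s′ j
      conj : ∀ {a b c} → a ≡ true → b ≡ true → c ≡ true → a ∧ b ∧ c ≡ true
      conj refl refl refl = refl
      coords : (π : Point → ∣ A ∣) (v : Vec ∣ A ∣ (arity σ i)) → (∀ j → π (x j) ≡ lookup v j) →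
        map π (tabulate x) ≡ v
      coords π v eq = lookup-ext λ j →
        trans (Vecₚ.lookup-map j π (tabulate x)) (trans (cong π (Vecₚ.lookup∘tabulate x j)) (eq j))
      level-at : ∀ j → toℕ (lookup (map proj₁ (tabulate x)) j) ≡ toℕ (clamp (ls j))
      level-at j = cong toℕ (trans (Vecₚ.lookup-map j proj₁ (tabulate x)) (cong proj₁ (Vecₚ.lookup∘tabulate x j)))
      edge : ∀ j → ls j ≡ l ⊎ ls j ≡ suc l → toℕ (lookup (map proj₁ (tabulate x)) j) ≡ toℕ (fromℕ< l<n)
        ⊎ toℕ (lookup (map proj₁ (tabulate x)) j) ≡ suc (toℕ (fromℕ< l<n))
      edge j (inj₁ eq) = inj₁ (trans (level-at j) (trans (cong (toℕ ∘ clamp) eq)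
        (trans (toℕ-clamp (ℕₚ.<⇒≤ l<n)) (sym (Finₚ.toℕ-fromℕ< l<n)))))
      edge j (inj₂ eq) = inj₂ (trans (level-at j) (trans (cong (toℕ ∘ clamp) eq)
        (trans (toℕ-clamp l<n) (cong suc (sym (Finₚ.toℕ-fromℕ< l<n))))))

definable⇒Chain : (σ : Signature) → ((i : Fin (m σ)) → 1 ≤ arity σ i) →
  (K : Structure σ → Set) (A : Structure σ) → PinchClosed K A → DisjointUnionClosed K →
  (φ : Sentence σ) → Defines K A φ → Σ ℕ λ n′ → Chain A (suc n′)
definable⇒Chain σ arity≥1 K A pinchClosed unionClosed φ defines =
  n′ , whole-chain A n′ tγ zero (tγ≡ zero) (Equivalence.from (defines _ Kγ)
    (transfer {β = board tβ} {γ = board tγ} fresh-β fresh-γ q φ ℕₚ.≤-refl ℕₚ.≤-refl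
      (ℕₚ.≤-reflexive (ℕₚ.+-identityʳ q)) start-position
      (Equivalence.to (defines _ Kβ) (Family.hom-half (hasStart ∘ tβ) (hasFinish ∘ tβ)
        λ c → subst (λ κ → hasFinish κ ≡ not (hasStart κ)) (sym (tβ≡ c)) (halves-half (splitAt (suc q) c))))))
  where
  q n′ : ℕ
  q = quantifierRank φ
  -- Makes the length of the pinch `suc (reach q)`, just above the radius `reach q` at which the
  -- game begins.
  n′ = reach q
  open Pinch A n′
  open Game A n′ arity≥1
  open Closed K pinchClosed unionClosed using (fam-K)

  half : ∀ {k l} → Fin k ⊎ Fin l → Kind
  half (inj₁ _) = left
  half (inj₂ _) = right

  -- With `suc q` halves of each kind, `q` pebbles always leave one of each unoccupied.
  halves : Fin (suc q + suc q) → Kind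
  halves c = half (splitAt (suc q) c)

  halves-half : ∀ {k l} (c : Fin k ⊎ Fin l) → hasFinish (half c) ≡ not (hasStart (half c))
  halves-half (inj₁ _) = refl
  halves-half (inj₂ _) = refl

  β-K = fam-K halves
  γ-K = fam-K (extend whole halves)
  tβ = proj₁ β-K
  tγ = proj₁ γ-K
  tβ≡ = proj₁ (proj₂ β-K)
  tγ≡ = proj₁ (proj₂ γ-K)
  Kβ = proj₂ (proj₂ β-K)
  Kγ = proj₂ (proj₂ γ-K)

  board : ∀ {k} → (Fin k → Kind) → Board
  board ty = record { hs = hasStart ∘ ty ; hf = hasFinish ∘ ty }

  supply : ∀ {k} (ty : Fin k → Kind) (g : Fin (suc q + suc q) → Fin k) →
    (∀ {i j} → g i ≡ g j → i ≡ j) → (∀ c → ty (g c) ≡ halves c) → Fresh (board ty) q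
  supply ty g inj eq = fresh (board ty) q λ
    { true → g ∘ (_↑ˡ suc q) , Finₚ.↑ˡ-injective (suc q) _ _ ∘ inj ,
        λ j → cong hasStart (at-left j) , cong hasFinish (at-left j)
    ; false → g ∘ (suc q ↑ʳ_) , Finₚ.↑ʳ-injective (suc q) _ _ ∘ inj ,
        λ j → cong hasStart (at-right j) , cong hasFinish (at-right j) }
    where
    at-left : ∀ j → ty (g (j ↑ˡ suc q)) ≡ left
    at-left j = trans (eq _) (cong half (Finₚ.splitAt-↑ˡ (suc q) j (suc q)))
    at-right : ∀ j → ty (g (suc q ↑ʳ j)) ≡ right
    at-right j = trans (eq _) (cong half (Finₚ.splitAt-↑ʳ (suc q) (suc q) j))

  fresh-β : Fresh (board tβ) q
  fresh-β = supply tβ id id tβ≡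

  fresh-γ : Fresh (board tγ) q
  fresh-γ = supply tγ suc Finₚ.suc-injective (tγ≡ ∘ suc)

  start-position : Position (reach q) (board tβ) (board tγ) noVars noVars
  start-position = record { same = λ () ; together = λ () ; start = λ () ; finish = λ () }

-- Arc consistency

module Consistency {σ : Signature} (A B : Structure σ) where

  -- S k b a: the value a for b survives k rounds of arc consistency.
  S : ℕ → ∣ B ∣ → ∣ A ∣ → Set
  Support : ℕ → (i : Fin (m σ)) → Vec ∣ B ∣ (arity σ i) → Fin (arity σ i) → ∣ A ∣ → Set

  S zero b a = ⊤
  S (suc k) b a = S k b a ×
    (∀ i t p → Rel B i t ≡ true → lookup t p ≡ b → Support k i t p a)

  Support k i t p a = Σ (Vec ∣ A ∣ (arity σ i)) λ s →
    (Rel A i s ≡ true) × (lookup s p ≡ a) × (∀ j → S k (lookup t j) (lookup s j))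

  _≟A_ : (x y : ∣ A ∣) → Dec (x ≡ y)
  _≟A_ = finite-≟ (finite A)

  _≟B_ : (x y : ∣ B ∣) → Dec (x ≡ y)
  _≟B_ = finite-≟ (finite B)

  abstract
    S? : ∀ k b a → Dec (S k b a)
    Support? : ∀ k i t p a → Dec (Support k i t p a)

    S? zero b a = yes tt
    S? (suc k) b a = S? k b a ×-dec
      Finₚ.all? λ i → vec-all? (finite B) λ t → Finₚ.all? λ p →
        (Rel B i t Boolₚ.≟ true) →-dec ((lookup t p ≟B b) →-dec Support? k i t p a)

    Support? k i t p a = vec-any? (finite A) λ s →
      (Rel A i s Boolₚ.≟ true) ×-dec ((lookup s p ≟A a) ×-dec
        Finₚ.all? λ j → S? k (lookup t j) (lookup s j))

  module _ {n′ : ℕ} (chain : Chain A (suc n′)) where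
    open Chain chain

    n : ℕ
    n = suc n′

    -- Here `y` may have survived far fewer rounds than `x`. In the support at `p`, level `suc l` is
    -- used at `p`, where `x` and `y` themselves stand, and level `l` elsewhere, where the support
    -- of `y` has lost one round. The budget `l ≤ m` is thus preserved, and at level 0 the second
    -- argument no longer matters.
    S-closed : ∀ k m l {b x y} → l ≤ m → l ≤ n → S k b x → S m b y → S k b (G l x y)
    S-closed zero _ _ _ _ _ _ = tt
    S-closed (suc k) m zero {b} {x} {y} l≤m l≤n Sx Sy =
      S-closed k m zero l≤m l≤n (proj₁ Sx) Sy , λ i t p t∈ tp →
        let s , s∈ , sp , Ss = proj₂ Sx i t p t∈ tp
            g = λ j → G 0 (lookup s j) (lookup s j)
        in tabulate g
         , G-hom (s≤s z≤n) i (λ _ → 0) (λ _ → inj₁ refl) s s s∈ s∈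
         , trans (Vecₚ.lookup∘tabulate g p) (trans (cong (λ z → G 0 z z) sp) G-start)
         , λ j → subst (S k _) (sym (Vecₚ.lookup∘tabulate g j))
             (S-closed k k zero z≤n z≤n (Ss j) (Ss j))
    S-closed (suc k) (suc m) (suc l) {b} {x} {y} (s≤s l≤m) l≤n Sx Sy =
      S-closed k (suc m) (suc l) (s≤s l≤m) l≤n (proj₁ Sx) Sy , λ i t p t∈ tp →
        let s , s∈ , sp , Ss = proj₂ Sx i t p t∈ tp
            s′ , s′∈ , s′p , Ss′ = proj₂ Sy i t p t∈ tp
            ls = λ j → if does (j Finₚ.≟ p) then suc l else l
            g = λ j → G (ls j) (lookup s j) (lookup s′ j)
            mixed : ∀ j → ls j ≡ l ⊎ ls j ≡ suc l
            mixed j = if-either (does (j Finₚ.≟ p))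
            at-p : g p ≡ G (suc l) x y
            at-p = trans (cong (λ d → G (if d then suc l else l) (lookup s p) (lookup s′ p)) (dec-true (p Finₚ.≟ p) refl))
              (cong₂ (G (suc l)) sp s′p)
            Sg : ∀ j → S k (lookup t j) (g j)
            Sg j = at {t = t} j (j Finₚ.≟ p) s s′ Ss Ss′ sp s′p tp
        in tabulate g
         , G-hom l≤n i ls mixed s s′ s∈ s′∈
         , trans (Vecₚ.lookup∘tabulate g p) at-p
         , λ j → subst (S k _) (sym (Vecₚ.lookup∘tabulate g j)) (Sg j)
      where
      if-either : ∀ d → (if d then suc l else l) ≡ l ⊎ (if d then suc l else l) ≡ suc l
      if-either true = inj₂ refl
      if-either false = inj₁ refl
      at : ∀ {r} {t : Vec ∣ B ∣ r} {p} j (d : Dec (j ≡ p)) s s′ →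
        (∀ j → S k (lookup t j) (lookup s j)) → (∀ j → S m (lookup t j) (lookup s′ j)) →
        lookup s p ≡ x → lookup s′ p ≡ y → lookup t p ≡ b →
        S k (lookup t j) (G (if does d then suc l else l) (lookup s j) (lookup s′ j))
      at j (yes refl) s s′ _ _ refl refl refl =
        S-closed k (suc m) (suc l) (s≤s l≤m) l≤n (proj₁ Sx) Sy
      at j (no _) s s′ Ss Ss′ _ _ _ =
        S-closed k m l l≤m (ℕₚ.≤-trans (ℕₚ.n≤1+n l) l≤n) (Ss j) (Ss′ j)

    -- The last level of the chain depends on its second argument only, so any element of
    -- S k carries an element of S n into S k.
    S-finish : ∀ k {b y} → (Σ ∣ A ∣ (S k b)) → S n b y → S k b (G n y y)
    S-finish k (x , Sx) Sy = subst (S k _) G-finish (S-closed k n n ℕₚ.≤-refl ℕₚ.≤-refl Sx Sy)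

    -- The diagonal of `G n` carries `S n` into the nonempty `S k` at every element of `B`
    -- simultaneously. A value `y` in `S (suc n)` has supports in `S n`; their images support
    -- `G n y y`, which therefore survives round `suc k`. This spends the one round beyond `n`.
    S-nonempty : (∀ b → Σ ∣ A ∣ (S (suc n) b)) → ∀ k b → Σ ∣ A ∣ (S k b)
    S-nonempty start zero b = proj₁ (start b) , tt
    S-nonempty start (suc k) b with start b
    ... | y , Sy = G n y y , S-finish k (S-nonempty start k b) (proj₁ Sy) , λ i t p t∈ tp →
      let s , s∈ , sp , Ss = proj₂ Sy i t p t∈ tp
          g = λ j → G n (lookup s j) (lookup s j)
      in tabulate g
       , G-hom ℕₚ.≤-refl i (λ _ → n) (λ _ → inj₂ refl) s s s∈ s∈
       , trans (Vecₚ.lookup∘tabulate g p) (cong (λ z → G n z z) sp)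
       , λ j → subst (S k _) (sym (Vecₚ.lookup∘tabulate g j))
           (S-finish k (S-nonempty start k (lookup t j)) (Ss j))

    -- Each round that removes a value lowers the count, so removal stops. The search starts at `n`
    -- because `S-closed` with `m = k` then covers all levels of the chain.
    S-stable : Σ ℕ λ k → n ≤ k × (∀ {b a} → S k b a → S (suc k) b a)
    S-stable = go n ℕₚ.≤-refl (<-wellFounded _)
      where
      F : Finite (∣ B ∣ × ∣ A ∣)
      F = finite B ×-finite finite A
      dec : ∀ k (u : ∣ B ∣ × ∣ A ∣) → Dec (S k (proj₁ u) (proj₂ u))
      dec k (b , a) = S? k b a
      go : ∀ k → n ≤ k → Acc _<_ (count F (dec k)) → Σ ℕ λ k → n ≤ k × (∀ {b a} → S k b a → S (suc k) b a)
      go k n≤k (acc rs) with finite-any? F (λ u → dec k u ×-dec ¬? (dec (suc k) u))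
      ... | no ¬drop = k , n≤k , λ {b} {a} Sk → decidable-stable (S? (suc k) b a)
            λ ¬S → ¬drop ((b , a) , Sk , ¬S)
      ... | yes (u , Sk , ¬S) = go (suc k) (ℕₚ.≤-trans n≤k (ℕₚ.n≤1+n k))
            (rs (count-< F (dec (suc k)) (dec k) (λ _ → proj₁) u Sk ¬S))

record ConsistentFamily {σ : Signature} {A : Structure σ} {n : ℕ} (chain : Chain A n) (B : Structure σ) : Set₁ where
  open Chain chain
  field
    V : ∣ B ∣ → ∣ A ∣ → Set
    V? : ∀ b a → Dec (V b a)
    V-nonempty : ∀ b → Σ ∣ A ∣ (V b)
    V-support : ∀ i t p {a} → Rel B i t ≡ true → V (lookup t p) a →
      Σ (Fin (arity σ i) → ∣ A ∣) λ s →
        (Rel A i (tabulate s) ≡ true) × (s p ≡ a) × (∀ j → V (lookup t j) (s j))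
    V-closed : ∀ {l b x y} → l ≤ n → V b x → V b y → V b (G l x y)

consistentFamily : ∀ {σ} {A B : Structure σ} {n′} (chain : Chain A (suc n′)) →
  (∀ b → Σ ∣ A ∣ (Consistency.S A B (suc (suc n′)) b)) → ConsistentFamily chain B
consistentFamily {A = A} {B} chain start with Consistency.S-stable A B chain
... | k , n≤k , stable = record
  { V = S k
  ; V? = S? k
  ; V-nonempty = S-nonempty chain start k
  ; V-support = λ i t p t∈ Va → let s , s∈ , sp , Ss = proj₂ (stable Va) i t p t∈ refl in
      lookup s , trans (cong (Rel A i) (Vecₚ.tabulate∘lookup s)) s∈ , sp , Ss
  ; V-closed = λ {l} l≤n Vx Vy → S-closed chain k k l (ℕₚ.≤-trans l≤n n≤k) l≤n Vx Vy
  }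
  where open Consistency A B

-- Dismantling

iter-suc : ∀ {X : Set} (f : X → X) k x → iter f k (f x) ≡ iter f (suc k) x
iter-suc f zero x = refl
iter-suc f (suc k) x = cong f (iter-suc f k x)

iter-suc-cong : ∀ {X : Set} (f : X → X) k {x y} → f x ≡ f y → iter f (suc k) x ≡ iter f (suc k) y
iter-suc-cong f zero eq = eq
iter-suc-cong f (suc k) eq = cong f (iter-suc-cong f k eq)

first-change : (P : ℕ → Set) → (∀ l → Dec (P l)) → ¬ P 0 → ∀ n → P n →
  Σ ℕ λ l → l < n × ¬ P l × P (suc l)
first-change P P? ¬P0 zero Pn = ⊥-elim (¬P0 Pn)
first-change P P? ¬P0 (suc n) Pn with P? n
... | no ¬p = n , ℕₚ.≤-refl , ¬p , Pn
... | yes p with first-change P P? ¬P0 n p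
...   | l , l<n , rest = l , ℕₚ.<-trans l<n ℕₚ.≤-refl , rest

module Dismantle {σ : Signature} {A : Structure σ} {n : ℕ} (chain : Chain A n) {B : Structure σ}
  (family : ConsistentFamily chain B) (arity≥1 : (i : Fin (m σ)) → 1 ≤ arity σ i) where

  open Chain chain
  open ConsistentFamily family

  private
    X : Set
    X = ∣ B ∣ × ∣ A ∣

    finite-X : Finite X
    finite-X = finite B ×-finite finite A

    _≟X_ : (x y : X) → Dec (x ≡ y)
    _≟X_ = finite-≟ finite-X

    _≟A_ : (x y : ∣ A ∣) → Dec (x ≡ y)
    _≟A_ = finite-≟ (finite A)

  -- The tuples of the structure on {(b , a) : V b a} induced from B × A.
  Tuple : ∀ i (t : Vec ∣ B ∣ (arity σ i)) → (Fin (arity σ i) → ∣ A ∣) → Set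
  Tuple i t s = (Rel A i (tabulate s) ≡ true) × (∀ j → V (lookup t j) (s j))

  Tuple-≗ : ∀ {i t s s′} → (∀ j → s j ≡ s′ j) → Tuple i t s → Tuple i t s′
  Tuple-≗ {i} eq (s∈ , Vs) = trans (cong (Rel A i) (sym (Vecₚ.tabulate-cong eq))) s∈ ,
    λ j → subst (V _) (eq j) (Vs j)

  record Endo (e : ∣ B ∣ → ∣ A ∣ → ∣ A ∣) : Set where
    field
      keeps : ∀ {b a} → V b a → V b (e b a)
      hom : ∀ {i t s} → Rel B i t ≡ true → Tuple i t s → Rel A i (tabulate λ j → e (lookup t j) (s j)) ≡ true
    tuple : ∀ {i t s} → Rel B i t ≡ true → Tuple i t s → Tuple i t (λ j → e (lookup t j) (s j))
    tuple t∈ st = hom t∈ st , λ j → keeps (proj₂ st j)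

  open Endo

  Endo-id : Endo (λ _ a → a)
  Endo-id = record { keeps = id ; hom = λ _ → proj₁ }

  Endo-∘ : ∀ {e e′} → Endo e → Endo e′ → Endo (λ b a → e b (e′ b a))
  Endo-∘ E E′ = record { keeps = keeps E ∘ keeps E′ ; hom = λ t∈ st → hom E t∈ (tuple E′ t∈ st) }

  Endo-iter : ∀ {e} → Endo e → ∀ k → Endo (λ b → iter (e b) k)
  Endo-iter E zero = Endo-id
  Endo-iter E (suc k) = Endo-∘ E (Endo-iter E k)

  G-tuple : ∀ {l} → l < n → ∀ {i t} (ls : Fin (arity σ i) → ℕ) → (∀ j → ls j ≡ l ⊎ ls j ≡ suc l) →
    ∀ {s s′} → Tuple i t s → Tuple i t s′ → Tuple i t (λ j → G (ls j) (s j) (s′ j))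
  G-tuple {l} l<n {i} ls mixed {s} {s′} (s∈ , Vs) (s′∈ , Vs′) =
      trans (cong (Rel A i) (Vecₚ.tabulate-cong λ j → sym (cong₂ (G (ls j))
        (Vecₚ.lookup∘tabulate s j) (Vecₚ.lookup∘tabulate s′ j))))
        (G-hom l<n i ls mixed (tabulate s) (tabulate s′) s∈ s′∈)
    , λ j → V-closed (bound (mixed j)) (Vs j) (Vs′ j)
    where
    bound : ∀ {k} → k ≡ l ⊎ k ≡ suc l → k ≤ n
    bound (inj₁ refl) = ℕₚ.<⇒≤ l<n
    bound (inj₂ refl) = l<n

  -- Values of one element that `e` keeps apart; the number of such pairs is the measure that
  -- folding lowers.
  Split : (∣ B ∣ → ∣ A ∣ → ∣ A ∣) → X × ∣ A ∣ → Set
  Split e ((b , a) , a′) = V b a × V b a′ × ¬ e b a ≡ e b a′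

  finite-pairs : Finite (X × ∣ A ∣)
  finite-pairs = finite-X ×-finite finite A

  Split? : ∀ e u → Dec (Split e u)
  Split? e ((b , a) , a′) = V? b a ×-dec (V? b a′ ×-dec ¬? (e b a ≟A e b a′))

  -- When `e` is constant on every fibre, its value at an entry of a tuple may be computed from any
  -- support of that tuple, and `e` preserves the relation on the support.
  constant⇒hom : ∀ {e} → Endo e → ¬ Σ (X × ∣ A ∣) (Split e) → HomTo B A
  constant⇒hom {e} E ¬split = h , h-hom
    where
    h : ∣ B ∣ → ∣ A ∣
    h b = e b (proj₁ (V-nonempty b))
    h-hom : IsHom B A h
    h-hom i t t∈ with V-support i t (fromℕ< (arity≥1 i)) t∈ (proj₂ (V-nonempty _))
    ... | s , s∈ , _ , Vs = trans
      (cong (Rel A i) (lookup-ext λ j → trans (Vecₚ.lookup-map j h t)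
        (trans (decidable-stable (_ ≟A _) λ ne →
            ¬split ((_ , _) , proj₂ (V-nonempty (lookup t j)) , Vs j , ne))
          (sym (Vecₚ.lookup∘tabulate (λ j → e (lookup t j) (s j)) j)))))
      (hom E t∈ (s∈ , Vs))

  module _ {e : ∣ B ∣ → ∣ A ∣ → ∣ A ∣} (E : Endo e) (1≤n : 1 ≤ n) where

    private
      -- Level 0 is unary in effect, so after `e` it amounts to this self-map of each fibre, some
      -- power of which is idempotent.
      u : ∣ B ∣ → ∣ A ∣ → ∣ A ∣
      u b a = G 0 (e b a) (e b a)

      u-endo : Endo u
      u-endo = record
        { keeps = λ Va → V-closed z≤n (keeps E Va) (keeps E Va)
        ; hom = λ {_} {t} t∈ st → proj₁ (G-tuple 1≤n {t = t} (λ _ → 0) (λ _ → inj₁ refl) (tuple E t∈ st) (tuple E t∈ st)) }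

      -- All fibres are iterated together, so that one exponent makes `r b` idempotent for every
      -- `b`.
      U : X → X
      U (b , a) = b , u b a

      iter-U : ∀ k b a → iter U k (b , a) ≡ (b , iter (u b) k a)
      iter-U zero b a = refl
      iter-U (suc k) b a = cong U (iter-U k b a)

      k : ℕ
      k = proj₁ (idempotent-iterate finite-X U)

      r : ∣ B ∣ → ∣ A ∣ → ∣ A ∣
      r b = iter (u b) (suc k)

      r-endo : Endo r
      r-endo = Endo-iter u-endo (suc k)

      r-r : ∀ b a → r b (r b a) ≡ r b a
      r-r b a = trans (sym (cong proj₂ (iter-U (suc k) b (r b a))))
        (trans (cong (proj₂ ∘ iter U (suc k)) (sym (iter-U (suc k) b a)))
        (trans (cong proj₂ (proj₂ (idempotent-iterate finite-X U) (b , a)))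
          (cong proj₂ (iter-U (suc k) b a))))

      r-cong : ∀ b {a a′} → e b a ≡ e b a′ → r b a ≡ r b a′
      r-cong b eq = iter-suc-cong (u b) k (cong (λ z → G 0 z z) eq)

      Fix : ∣ B ∣ → ∣ A ∣ → Set
      Fix b a = r b a ≡ a

      -- The outer power of u is chosen so that level 0 is the first projection on Fix.
      H : ℕ → ∣ B ∣ → ∣ A ∣ → ∣ A ∣ → ∣ A ∣
      H l b x y = r b (iter (u b) k (G l (e b x) (e b y)))

      H-start : ∀ {b x y} → Fix b x → H 0 b x y ≡ x
      H-start {b} {x} {y} fx = begin
        r b (iter (u b) k (G 0 (e b x) (e b y))) ≡⟨ cong (r b ∘ iter (u b) k) G-start ⟩
        r b (iter (u b) k (u b x))               ≡⟨ cong (r b) (iter-suc (u b) k x) ⟩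
        r b (r b x)                              ≡⟨ cong (r b) fx ⟩
        r b x                                    ≡⟨ fx ⟩
        x                                        ∎
        where open ≡-Reasoning

      H-finish : ∀ {b x x′ y} → H n b x y ≡ H n b x′ y
      H-finish {b} = cong (r b ∘ iter (u b) k) G-finish

      H-tuple : ∀ {l} → l < n → ∀ {i t} → Rel B i t ≡ true → (ls : Fin (arity σ i) → ℕ) →
        (∀ j → ls j ≡ l ⊎ ls j ≡ suc l) → ∀ {s s′} → Tuple i t s → Tuple i t s′ →
        Tuple i t (λ j → H (ls j) (lookup t j) (s j) (s′ j))
      H-tuple l<n {t = t} t∈ ls mixed st s′t = tuple r-endo t∈ (tuple (Endo-iter u-endo k) t∈
        (G-tuple l<n {t = t} ls mixed (tuple E t∈ st) (tuple E t∈ s′t)))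

      Moved : ℕ → X × ∣ A ∣ → Set
      Moved l ((b , x) , y) = (V b x × Fix b x) × (V b y × Fix b y) × ¬ H l b x y ≡ x

      Moved? : ∀ l u → Dec (Moved l u)
      Moved? l ((b , x) , y) = (V? b x ×-dec (r b x ≟A x)) ×-dec
        ((V? b y ×-dec (r b y ≟A y)) ×-dec ¬? (H l b x y ≟A x))

      moved? : ∀ l → Dec (Σ (X × ∣ A ∣) (Moved l))
      moved? l = finite-any? finite-pairs (Moved? l)

      not-moved-start : ¬ Σ (X × ∣ A ∣) (Moved 0)
      not-moved-start (_ , (_ , fx) , _ , ne) = ne (H-start fx)

      -- Otherwise level n would be the first projection, although it ignores its first argument.
      moved-finish : Σ (X × ∣ A ∣) (Split r) → Σ (X × ∣ A ∣) (Moved n)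
      moved-finish (((b , a) , a′) , Va , Va′ , ne) = decidable-stable (moved? n) λ ¬moved →
        let stay : ∀ {x y} → V b x → Fix b x → V b y → Fix b y → H n b x y ≡ x
            stay Vx fx Vy fy = decidable-stable (_ ≟A _) λ ne → ¬moved (_ , (Vx , fx) , (Vy , fy) , ne)
            Vr = keeps r-endo Va
            Vr′ = keeps r-endo Va′
        in ne (trans (sym (stay Vr (r-r b a) Vr′ (r-r b a′)))
             (trans H-finish (stay Vr′ (r-r b a′) Vr′ (r-r b a′))))

    -- On the fixed points of `r`, level `l` is the first projection, while level `suc l` sends `x₀`
    -- to a different `w₀`. Mixing these two levels in a tuple changes a single entry, so
    -- redirecting `x₀` to `w₀` preserves tuples of fixed points.
    module Fold {l} (l<n : l < n) (still : ¬ Σ (X × ∣ A ∣) (Moved l))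
      {b₀ x₀ y₀} (moved : Moved (suc l) ((b₀ , x₀) , y₀)) where

      w₀ : ∣ A ∣
      w₀ = H (suc l) b₀ x₀ y₀

      w₀≢x₀ : ¬ w₀ ≡ x₀
      w₀≢x₀ = proj₂ (proj₂ moved)

      V-w₀ : V b₀ w₀
      V-w₀ = keeps r-endo (keeps (Endo-iter u-endo k) (V-closed l<n
        (keeps E (proj₁ (proj₁ moved))) (keeps E (proj₁ (proj₁ (proj₂ moved))))))

      Fix-w₀ : Fix b₀ w₀
      Fix-w₀ = r-r b₀ _

      fold : ∣ B ∣ → ∣ A ∣ → ∣ A ∣
      fold b a = if does ((b , a) ≟X (b₀ , x₀)) then w₀ else a

      fold-x₀ : fold b₀ x₀ ≡ w₀
      fold-x₀ = cong (if_then w₀ else x₀) (dec-true ((b₀ , x₀) ≟X (b₀ , x₀)) refl)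

      fold-other : ∀ {b a} → ¬ (b , a) ≡ (b₀ , x₀) → fold b a ≡ a
      fold-other {b} {a} ne with (b , a) ≟X (b₀ , x₀)
      ... | yes eq = ⊥-elim (ne eq)
      ... | no _ = refl

      FixTuple : ∀ i (t : Vec ∣ B ∣ (arity σ i)) → (Fin (arity σ i) → ∣ A ∣) → Set
      FixTuple i t s = Tuple i t s × (∀ j → Fix (lookup t j) (s j))

      module _ {i} {t : Vec ∣ B ∣ (arity σ i)} (t∈ : Rel B i t ≡ true) where

        replace : (Fin (arity σ i) → ∣ A ∣) → Fin (arity σ i) → Fin (arity σ i) → ∣ A ∣
        replace z p j = if does (j Finₚ.≟ p) then w₀ else z j

        -- A support of y₀ at p is combined with z: level l + 1 at p, level l elsewhere.
        replace-one : ∀ {z} → FixTuple i t z → ∀ p → (lookup t p , z p) ≡ (b₀ , x₀) →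
          FixTuple i t (replace z p)
        replace-one {z} (zt , fz) p eq with cong proj₁ eq | cong proj₂ eq
        ... | refl | refl with V-support i t p t∈ (proj₁ (proj₁ (proj₂ moved)))
        ...   | s , s∈ , sp , Vs = Tuple-≗ {i} {t} pointwise (H-tuple l<n t∈ ls mixed zt yt)
              , λ j → subst (Fix (lookup t j)) (pointwise j) (r-r _ _)
          where
          y : Fin (arity σ i) → ∣ A ∣
          y j = r (lookup t j) (s j)
          yt : Tuple i t y
          yt = tuple r-endo t∈ (s∈ , Vs)
          ls : Fin (arity σ i) → ℕ
          ls j = if does (j Finₚ.≟ p) then suc l else l
          mixed : ∀ j → ls j ≡ l ⊎ ls j ≡ suc l
          mixed j with does (j Finₚ.≟ p)
          ... | true = inj₂ refl
          ... | false = inj₁ refl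
          pointwise : ∀ j → H (ls j) (lookup t j) (z j) (y j) ≡ replace z p j
          pointwise j with j Finₚ.≟ p
          ... | yes refl = cong (H (suc l) (lookup t j) (z j))
                (trans (cong (r (lookup t j)) sp) (proj₂ (proj₁ (proj₂ moved))))
          ... | no _ = decidable-stable (_ ≟A _) λ ne →
                still (_ , (proj₂ zt j , fz j) , (proj₂ yt j , r-r _ _) , ne)

        Partial : (Fin (arity σ i) → ∣ A ∣) → ℕ → Set
        Partial z c = Σ (Fin (arity σ i) → ∣ A ∣) λ z′ → FixTuple i t z′ ×
          (∀ j → toℕ j < c → z′ j ≡ fold (lookup t j) (z j)) × (∀ j → c ≤ toℕ j → z′ j ≡ z j)

        -- The pair `(b₀ , x₀)` may occur at several positions, so `fold` is realised one position
        -- at a time; each intermediate tuple consists of fixed points, as the next replacement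
        -- requires.
        replace-many : ∀ {z} → FixTuple i t z → ∀ c → c ≤ arity σ i → Partial z c
        replace-many {z} zt zero _ = z , zt , (λ _ ()) , λ _ _ → refl
        replace-many {z} zt (suc c) c<r with replace-many zt c (ℕₚ.<⇒≤ c<r)
        ... | z′ , z′t , below , above = next (_ ≟X _)
          where
          p : Fin (arity σ i)
          p = fromℕ< c<r
          toℕ-p : toℕ p ≡ c
          toℕ-p = Finₚ.toℕ-fromℕ< c<r
          z′p : z′ p ≡ z p
          z′p = above p (ℕₚ.≤-reflexive (sym toℕ-p))
          below-suc : ∀ {j} → toℕ j < suc c → toℕ j < c ⊎ j ≡ p
          below-suc {j} (s≤s j≤c) with ℕₚ.m≤n⇒m<n∨m≡n j≤c
          ... | inj₁ j<c = inj₁ j<c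
          ... | inj₂ j≡c = inj₂ (Finₚ.toℕ-injective (trans j≡c (sym toℕ-p)))
          next : Dec ((lookup t p , z p) ≡ (b₀ , x₀)) → Partial z (suc c)
          next (no ne) = z′ , z′t
            , (λ j j<c → extend-below j (below-suc j<c))
            , λ j c<j → above j (ℕₚ.<⇒≤ c<j)
            where
            extend-below : ∀ j → toℕ j < c ⊎ j ≡ p → z′ j ≡ fold (lookup t j) (z j)
            extend-below j (inj₁ j<c) = below j j<c
            extend-below .p (inj₂ refl) = trans z′p (sym (fold-other ne))
          next (yes eq) = replace z′ p
            , replace-one z′t p (trans (cong (lookup t p ,_) z′p) eq)
            , (λ j j<c → extend-below j (below-suc j<c))
            , λ j c<j → extend-above j c<j (j Finₚ.≟ p)
            where
            at-p : fold (lookup t p) (z p) ≡ w₀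
            at-p = trans (cong (λ (b , a) → fold b a) eq) fold-x₀
            extend-below : ∀ j → toℕ j < c ⊎ j ≡ p → replace z′ p j ≡ fold (lookup t j) (z j)
            extend-below j (inj₁ j<c) with j Finₚ.≟ p
            ... | yes refl = sym at-p
            ... | no _ = below j j<c
            extend-below .p (inj₂ refl) = trans (cong (if_then w₀ else z′ p) (dec-true (p Finₚ.≟ p) refl)) (sym at-p)
            extend-above : ∀ j → suc c ≤ toℕ j → (d : Dec (j ≡ p)) → (if does d then w₀ else z′ j) ≡ z j
            extend-above j c<j (yes refl) = ⊥-elim (ℕₚ.<-irrefl (sym toℕ-p) c<j)
            extend-above j c<j (no _) = above j (ℕₚ.<⇒≤ c<j)

      e′ : ∣ B ∣ → ∣ A ∣ → ∣ A ∣
      e′ b a = fold b (r b a)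

      e′-endo : Endo e′
      e′-endo = record { keeps = λ Va → V-fold (keeps r-endo Va) ; hom = e′-hom }
        where
        V-fold : ∀ {b a} → V b a → V b (fold b a)
        V-fold {b} {a} Va with (b , a) ≟X (b₀ , x₀)
        ... | yes refl = V-w₀
        ... | no _ = Va
        e′-hom : ∀ {i t s} → Rel B i t ≡ true → Tuple i t s →
          Rel A i (tabulate λ j → e′ (lookup t j) (s j)) ≡ true
        e′-hom {i} {t} t∈ st with replace-many t∈ (tuple r-endo t∈ st , λ j → r-r _ _) (arity σ i) ℕₚ.≤-refl
        ... | z , (zt , _) , below , _ = proj₁ (Tuple-≗ {i} {t} (λ j → below j (Finₚ.toℕ<n j)) zt)

      -- No pair is newly separated, since `r` factors through `e`. The pair `x₀`, `w₀` is separated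
      -- by `e`, as `r` fixes both, but `fold` merges it.
      fewer-splits : count finite-pairs (Split? e′) < count finite-pairs (Split? e)
      fewer-splits = count-< finite-pairs (Split? e′) (Split? e)
        (λ ((b , _) , _) (Va , Va′ , ne) → Va , Va′ , λ eq → ne (cong (fold b) (r-cong b eq)))
        ((b₀ , x₀) , w₀)
        (proj₁ (proj₁ moved) , V-w₀ , λ eq → w₀≢x₀ (sym
          (trans (sym (proj₂ (proj₁ moved))) (trans (r-cong b₀ eq) Fix-w₀))))
        λ (_ , _ , ne) → ne (trans (cong (fold b₀) (proj₂ (proj₁ moved))) (trans fold-x₀
          (sym (trans (cong (fold b₀) Fix-w₀) (fold-other λ eq → w₀≢x₀ (cong proj₂ eq))))))

    improve : HomTo B A ⊎ Σ (∣ B ∣ → ∣ A ∣ → ∣ A ∣) λ e′ →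
      Endo e′ × count finite-pairs (Split? e′) < count finite-pairs (Split? e)
    improve with finite-any? finite-pairs (Split? r)
    ... | no ¬split = inj₁ (constant⇒hom r-endo ¬split)
    -- Level 0 moves no fixed point and level `n` moves one, so the behaviour changes between some
    -- consecutive levels.
    ... | yes split with first-change (λ l → Σ (X × ∣ A ∣) (Moved l)) moved? not-moved-start n (moved-finish split)
    ...   | l , l<n , still , (_ , moved) = inj₂ (F.e′ , F.e′-endo , F.fewer-splits)
      where module F = Fold l<n still moved

  hom-exists : 1 ≤ n → HomTo B A
  hom-exists 1≤n = go Endo-id (<-wellFounded _)
    where
    go : ∀ {e} → Endo e → Acc _<_ (count finite-pairs (Split? e)) → HomTo B A
    go E (acc rs) with improve E 1≤n
    ... | inj₁ h = h
    ... | inj₂ (_ , E′ , lt) = go E′ (rs lt)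

-- Bounded obstructions

∈-concatMap : ∀ {X Y : Set} {f : X → List Y} {x y xs} → x ∈ xs → y ∈ f x → y ∈ concatMap f xs
∈-concatMap {f = f} x∈ y∈ = ∈-concatMap⁺ f (lose x∈ y∈)

length-concatMap-≤ : ∀ {X Y : Set} (f : X → List Y) {c} → (∀ x → length (f x) ≤ c) →
  ∀ xs → length (concatMap f xs) ≤ length xs * c
length-concatMap-≤ f h [] = z≤n
length-concatMap-≤ f h (x ∷ xs) = ℕₚ.≤-trans (ℕₚ.≤-reflexive (Listₚ.length-++ (f x)))
  (ℕₚ.+-mono-≤ (h x) (length-concatMap-≤ f h xs))

elements : ∀ {X} → Finite X → List X
elements (n , e) = List.tabulate (Inverse.to e)

∈-elements : ∀ {X} (F : Finite X) x → x ∈ elements F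
∈-elements F@(n , e) x = subst (_∈ elements F) (to-from F x) (∈-tabulate⁺ (Inverse.from e x))

length-elements : ∀ {X} (F : Finite X) → length (elements F) ≡ proj₁ F
length-elements (n , e) = Listₚ.length-tabulate (Inverse.to e)

bounded : ∀ {k} (f : Fin k → ℕ) → Σ ℕ λ R → ∀ i → f i ≤ R
bounded {zero} f = 0 , λ ()
bounded {suc k} f with bounded (f ∘ suc)
... | R , h = f zero + R , λ { zero → ℕₚ.m≤m+n _ R ; (suc i) → ℕₚ.≤-trans (h i) (ℕₚ.m≤n+m R _) }

sublists : ∀ {X : Set} → List X → List (List X)
sublists [] = [] ∷ []
sublists (x ∷ xs) = sublists xs ++ List.map (x ∷_) (sublists xs)

filter∈sublists : ∀ {X : Set} {P : X → Set} (P? : Decidable P) xs → filter P? xs ∈ sublists xs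
filter∈sublists P? [] = here refl
filter∈sublists P? (x ∷ xs) with does (P? x)
... | true = ∈-++⁺ʳ (sublists xs) (∈-map⁺ (x ∷_) (filter∈sublists P? xs))
... | false = ∈-++⁺ˡ (filter∈sublists P? xs)

vectors : ∀ N k → List (Vec (Fin N) k)
vectors N zero = [] ∷ []
vectors N (suc k) = concatMap (λ x → List.map (x ∷_) (vectors N k)) (allFin N)

∈-vectors : ∀ {N k} (v : Vec (Fin N) k) → v ∈ vectors N k
∈-vectors [] = here refl
∈-vectors (x ∷ v) = ∈-concatMap (∈-allFin x) (∈-map⁺ (x ∷_) (∈-vectors v))

-- The default element fills surplus positions, so that a short list can interpret any number of
-- variables.
padded : ∀ {X : Set} → List X → X → ℕ → X
padded [] d _ = d
padded (x ∷ xs) d zero = x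
padded (x ∷ xs) d (suc j) = padded xs d j

padded-∈ : ∀ {X : Set} {x d : X} {xs} → x ∈ xs → Σ ℕ λ j → j < length xs × padded xs d j ≡ x
padded-∈ (here refl) = 0 , s≤s z≤n , refl
padded-∈ (there x∈) with padded-∈ x∈
... | j , j< , eq = suc j , s≤s j< , eq

maxArity : (σ : Signature) → ℕ
maxArity σ = proj₁ (bounded (arity σ))

-- Bounds the number of elements of B that refute S k b a.
witnesses : {σ : Signature} → Structure σ → ℕ → ℕ
witnesses A zero = 0
witnesses {σ} A (suc k) = witnesses A k + (maxArity σ + maxArity σ * (size A * witnesses A k))

module _ {σ : Signature} (A B : Structure σ) where
  open Consistency A B

  -- A homomorphism from the substructure induced on `W`, extended arbitrarily to a total function
  -- so that no substructure has to be formed.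
  PartialHom : List ∣ B ∣ → (∣ B ∣ → ∣ A ∣) → Set
  PartialHom W f = ∀ i t → (∀ j → lookup t j ∈ W) → Rel B i t ≡ true → Rel A i (map f t) ≡ true

  PartialHom-⊆ : ∀ {W W′ f} → (∀ {x} → x ∈ W → x ∈ W′) → PartialHom W′ f → PartialHom W f
  PartialHom-⊆ W⊆ p i t t⊆W = p i t (W⊆ ∘ t⊆W)

  Obstruction : ℕ → ∣ B ∣ → ∣ A ∣ → Set
  Obstruction k b a = Σ (List ∣ B ∣) λ W → length W ≤ witnesses A k ×
    (∀ f → PartialHom W f → ¬ f b ≡ a)

  -- If `a` has no support at a tuple `t`, collect the entries of `t` together with refutations of
  -- all values failing at those entries. A partial homomorphism on them with `f b ≡ a` would make
  -- `map f t` a support of `a`.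
  obstruction : ∀ k b a → ¬ S k b a → Obstruction k b a
  refutation : ∀ k b a → List ∣ B ∣

  refutation k b a with S? k b a
  ... | yes _ = []
  ... | no ¬Sk = proj₁ (obstruction k b a ¬Sk)

  refutation-length : ∀ k b a → length (refutation k b a) ≤ witnesses A k
  refutation-sound : ∀ k b a f → PartialHom (refutation k b a) f → f b ≡ a → S k b a

  obstruction zero b a ¬S = ⊥-elim (¬S tt)
  obstruction (suc k) b a ¬S with S? k b a
  ... | no ¬Sk = let W , W≤ , sound = obstruction k b a ¬Sk in
    W , ℕₚ.≤-trans W≤ (ℕₚ.m≤m+n _ _) , sound
  ... | yes Sk with Finₚ.any? (λ i → vec-any? (finite B) λ t → Finₚ.any? λ p →
          (Rel B i t Boolₚ.≟ true) ×-dec ((lookup t p ≟B b) ×-dec ¬? (Support? k i t p a)))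
  ...   | no ¬bad = ⊥-elim (¬S (Sk , λ i t p t∈ tp → decidable-stable (Support? k i t p a)
            λ ¬s → ¬bad (i , t , p , t∈ , tp , ¬s)))
  ...   | yes (i , t , p , t∈ , tp , ¬s) = W , W≤ , sound
    where
    at : Fin (arity σ i) → List ∣ B ∣
    at j = concatMap (refutation k (lookup t j)) (elements (finite A))
    W : List ∣ B ∣
    W = List.tabulate (lookup t) ++ concatMap at (allFin (arity σ i))
    at≤ : ∀ j → length (at j) ≤ size A * witnesses A k
    at≤ j = ℕₚ.≤-trans
      (length-concatMap-≤ (refutation k (lookup t j)) (refutation-length k _) (elements (finite A)))
      (ℕₚ.≤-reflexive (cong (_* witnesses A k) (length-elements (finite A))))
    arity≤ : arity σ i ≤ maxArity σ
    arity≤ = proj₂ (bounded (arity σ)) i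
    W≤ : length W ≤ witnesses A (suc k)
    W≤ = begin
      length W
        ≡⟨ Listₚ.length-++ (List.tabulate (lookup t)) ⟩
      length (List.tabulate (lookup t)) + length (concatMap at (allFin (arity σ i)))
        ≤⟨ ℕₚ.+-mono-≤ (ℕₚ.≤-reflexive (Listₚ.length-tabulate (lookup t)))
             (length-concatMap-≤ at at≤ (allFin (arity σ i))) ⟩
      arity σ i + length (allFin (arity σ i)) * (size A * witnesses A k)
        ≡⟨ cong (λ l → arity σ i + l * _) (Listₚ.length-tabulate {n = arity σ i} id) ⟩
      arity σ i + arity σ i * (size A * witnesses A k)
        ≤⟨ ℕₚ.+-mono-≤ arity≤ (ℕₚ.*-monoˡ-≤ _ arity≤) ⟩
      maxArity σ + maxArity σ * (size A * witnesses A k)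
        ≤⟨ ℕₚ.m≤n+m _ (witnesses A k) ⟩
      witnesses A (suc k) ∎
      where open ℕₚ.≤-Reasoning
    sound : ∀ f → PartialHom W f → ¬ f b ≡ a
    sound f ph fb = ¬s (map f t
      , ph i t (λ j → ∈-++⁺ˡ (∈-tabulate⁺ j)) t∈
      , trans (Vecₚ.lookup-map p f t) (trans (cong f tp) fb)
      , λ j → subst (S k (lookup t j)) (sym (Vecₚ.lookup-map j f t))
          (refutation-sound k (lookup t j) (f (lookup t j)) f
            (PartialHom-⊆ (λ x∈ → ∈-++⁺ʳ (List.tabulate (lookup t))
              (∈-concatMap (∈-allFin j) (∈-concatMap (∈-elements (finite A) _) x∈))) ph) refl))

  refutation-length k b a with S? k b a
  ... | yes _ = z≤n
  ... | no ¬Sk = proj₁ (proj₂ (obstruction k b a ¬Sk))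

  refutation-sound k b a f ph fb with S? k b a
  ... | yes Sk = Sk
  ... | no ¬Sk = ⊥-elim (proj₂ (proj₂ (obstruction k b a ¬Sk)) f ph fb)

  -- The value of a partial homomorphism at `b` cannot be a refuted one when `W` contains all
  -- refutations.
  consistent : ∀ k b W → (∀ a → ∀ {x} → x ∈ refutation k b a → x ∈ W) →
    (Σ (∣ B ∣ → ∣ A ∣) (PartialHom W)) → Σ ∣ A ∣ (S k b)
  consistent k b W W⊇ (f , ph) = f b , refutation-sound k b (f b) f (PartialHom-⊆ (W⊇ (f b)) ph) refl

-- Anti-identities as forbidden patterns

module _ {σ : Signature} where

  Holds : (B : Structure σ) {N : ℕ} → (Fin N → ∣ B ∣) → Atom σ N → Set
  Holds B ρ α = ⟦ atomFormula α ⟧ B ρ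

  holds? : ∀ B {N} (ρ : Fin N → ∣ B ∣) → Decidable (Holds B ρ)
  holds? B ρ (relA i xs) = Rel B i (map ρ xs) Boolₚ.≟ true
  holds? B ρ (eqA x y) = finite-≟ (finite B) (ρ x) (ρ y)

  hom-holds : ∀ {B A : Structure σ} ((g , _) : HomTo B A) {N} {ρ : Fin N → ∣ B ∣} {τ : Fin N → ∣ A ∣} →
    (∀ j → τ j ≡ g (ρ j)) → ∀ {α} → Holds B ρ α → Holds A τ α
  hom-holds {A = A} (g , g-hom) {ρ = ρ} eq {relA i xs} h =
    trans (cong (Rel A i) (trans (Vecₚ.map-cong eq xs) (Vecₚ.map-∘ g ρ xs))) (g-hom i _ h)
  hom-holds (g , _) eq {eqA x y} h = trans (eq x) (trans (cong g h) (sym (eq y)))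

  negDisj⇔ : ∀ B {N} (ρ : Fin N → ∣ B ∣) α αs →
    ⟦ negDisj α αs ⟧ B ρ ⇔ Any (¬_ ∘ Holds B ρ) (α ∷ αs)
  negDisj⇔ B ρ α αs = mk⇔ (to α αs) (from α αs)
    where
    to : ∀ α αs → ⟦ negDisj α αs ⟧ B ρ → Any (¬_ ∘ Holds B ρ) (α ∷ αs)
    to α [] h = here h
    to α (β ∷ αs) (inj₁ h) = here h
    to α (β ∷ αs) (inj₂ h) = there (to β αs h)
    from : ∀ α αs → Any (¬_ ∘ Holds B ρ) (α ∷ αs) → ⟦ negDisj α αs ⟧ B ρ
    from α [] (here h) = h
    from α (β ∷ αs) (here h) = inj₁ h
    from α (β ∷ αs) (there h) = inj₂ (from β αs h)

  ⟦⟧-≗ : ∀ {N} (φ : Formula σ N) B {ρ τ : Fin N → ∣ B ∣} → (∀ j → ρ j ≡ τ j) → ⟦ φ ⟧ B ρ → ⟦ φ ⟧ B τ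
  ⟦⟧-≗ (relᶠ i xs) B eq h = trans (cong (Rel B i) (sym (Vecₚ.map-cong eq xs))) h
  ⟦⟧-≗ (x ≐ y) B eq h = trans (sym (eq x)) (trans h (eq y))
  ⟦⟧-≗ ⊤ᶠ B eq h = h
  ⟦⟧-≗ (¬ᶠ φ) B eq h = h ∘ ⟦⟧-≗ φ B (sym ∘ eq)
  ⟦⟧-≗ (φ ∧ᶠ ψ) B eq (h , k) = ⟦⟧-≗ φ B eq h , ⟦⟧-≗ ψ B eq k
  ⟦⟧-≗ (φ ∨ᶠ ψ) B eq (inj₁ h) = inj₁ (⟦⟧-≗ φ B eq h)
  ⟦⟧-≗ (φ ∨ᶠ ψ) B eq (inj₂ k) = inj₂ (⟦⟧-≗ ψ B eq k)
  ⟦⟧-≗ (∃ᶠ φ) B eq (b , h) = b , ⟦⟧-≗ φ B (λ { zero → refl ; (suc j) → eq j }) h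
  ⟦⟧-≗ (∀ᶠ φ) B eq h b = ⟦⟧-≗ φ B (λ { zero → refl ; (suc j) → eq j }) (h b)

  closeAll⇔ : ∀ B N (φ : Formula σ N) → B ⊨ closeAll N φ ⇔ (∀ ρ → ⟦ φ ⟧ B ρ)
  closeAll⇔ B zero φ = mk⇔ (λ h ρ → ⟦⟧-≗ φ B (λ ()) h) (λ h → h noVars)
  closeAll⇔ B (suc N) φ = mk⇔
    (λ h ρ → ⟦⟧-≗ φ B (λ { zero → refl ; (suc j) → refl })
      (Equivalence.to (closeAll⇔ B N (∀ᶠ φ)) h (ρ ∘ suc) (ρ zero)))
    (λ h → Equivalence.from (closeAll⇔ B N (∀ᶠ φ)) λ ρ b → h (extend b ρ))

  conjAI⇔ : ∀ B (θs : List (AntiIdentity σ)) →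
    B ⊨ conjAI θs ⇔ All (λ θ → B ⊨ antiIdentityFormula θ) θs
  conjAI⇔ B θs = mk⇔ (to θs) from
    where
    to : ∀ θs → B ⊨ conjAI θs → All (λ θ → B ⊨ antiIdentityFormula θ) θs
    to [] _ = []
    to (θ ∷ θs) (h , hs) = h ∷ to θs hs
    from : ∀ {θs} → All (λ θ → B ⊨ antiIdentityFormula θ) θs → B ⊨ conjAI θs
    from [] = tt
    from (h ∷ hs) = h , from hs

  module _ (A : Structure σ) (N′ : ℕ) where

    private
      N : ℕ
      N = suc N′

    relAtoms : List (Atom σ N)
    relAtoms = concatMap (λ i → List.map (relA i) (vectors N (arity σ i))) (allFin (m σ))

    ∈-relAtoms : ∀ i xs → relA i xs ∈ relAtoms
    ∈-relAtoms i xs = ∈-concatMap (∈-allFin i) (∈-map⁺ (relA i) (∈-vectors xs))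

    Satisfiable : List (Atom σ N) → Set
    Satisfiable αs = Σ (Vec ∣ A ∣ N) λ v → All (Holds A (lookup v)) αs

    satisfiable? : Decidable Satisfiable
    satisfiable? αs = vec-any? (finite A) λ v → all? (holds? A (lookup v)) αs

    -- The trivial equation keeps the list of atoms nonempty.
    antiIdentity : List (Atom σ N) → AntiIdentity σ
    antiIdentity αs = record { nvars = N ; atoms = eqA zero zero ∷ αs }

    -- A list of relational atoms describes a structure on the `N` variables, and satisfying it in
    -- `A` amounts to a homomorphism from that structure. The lists without one are forbidden.
    obstructions : List (AntiIdentity σ)
    obstructions = List.map antiIdentity (filter (¬? ∘ satisfiable?) (sublists relAtoms))

    hom⇒obstructions : ∀ B → HomTo B A → B ⊨ conjAI obstructions
    hom⇒obstructions B g = Equivalence.from (conjAI⇔ B obstructions)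
      (map⁺ (All.map sound (all-filter (¬? ∘ satisfiable?) (sublists relAtoms))))
      where
      sound : ∀ {αs} → ¬ Satisfiable αs → B ⊨ antiIdentityFormula (antiIdentity αs)
      sound {αs} ¬sat = Equivalence.from (closeAll⇔ B N _) λ ρ →
        -- The failing atom is sought behind the trivial equation, which always holds.
        Equivalence.from (negDisj⇔ B ρ _ αs) (there (¬All⇒Any¬ (holds? B ρ) αs λ hs →
          ¬sat (tabulate (proj₁ g ∘ ρ) ,
            All.map (λ {α} → hom-holds g (Vecₚ.lookup∘tabulate (proj₁ g ∘ ρ)) {α}) hs)))

    -- Let the variables enumerate `W`. All relational atoms true of them in `B` form a list that is
    -- not forbidden, hence is satisfied in `A`. Several variables may name one element, so `f`
    -- reads the assignment through a fixed choice of index.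
    obstructions⇒partialHom : ∀ B → B ⊨ conjAI obstructions →
      ∀ b W → length W ≤ N → Σ (∣ B ∣ → ∣ A ∣) (PartialHom A B W)
    obstructions⇒partialHom B B⊨ b W W≤N = f , f-hom
      where
      ρ : Fin N → ∣ B ∣
      ρ j = padded W b (toℕ j)

      ρ-index : ∀ {x} → x ∈ W → Σ (Fin N) λ j → ρ j ≡ x
      ρ-index x∈ with padded-∈ {d = b} x∈
      ... | j , j< , eq = fromℕ< j<N , trans (cong (padded W b) (Finₚ.toℕ-fromℕ< j<N)) eq
        where j<N = ℕₚ.<-≤-trans j< W≤N

      index : ∣ B ∣ → Fin N
      index x with Finₚ.any? (λ j → finite-≟ (finite B) (ρ j) x)
      ... | yes (j , _) = j
      ... | no _ = zero

      index-∈ : ∀ {x} → x ∈ W → ρ (index x) ≡ x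
      index-∈ {x} x∈ with Finₚ.any? (λ j → finite-≟ (finite B) (ρ j) x)
      ... | yes (_ , eq) = eq
      ... | no ¬j = ⊥-elim (¬j (ρ-index x∈))

      αs : List (Atom σ N)
      αs = filter (holds? B ρ) relAtoms

      sat : Satisfiable αs
      sat = decidable-stable (satisfiable? αs) λ ¬sat → Any¬⇒¬All
        (Equivalence.to (negDisj⇔ B ρ (eqA zero zero) αs) (Equivalence.to (closeAll⇔ B N _)
          (All.lookup (Equivalence.to (conjAI⇔ B obstructions) B⊨)
            (∈-map⁺ antiIdentity (∈-filter⁺ (¬? ∘ satisfiable?) (filter∈sublists (holds? B ρ) relAtoms) ¬sat))) ρ))
        (refl ∷ all-filter (holds? B ρ) relAtoms)

      f : ∣ B ∣ → ∣ A ∣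
      f x = lookup (proj₁ sat) (index x)

      f-hom : PartialHom A B W f
      f-hom i t t⊆W t∈ = trans (cong (Rel A i) (Vecₚ.map-∘ (lookup (proj₁ sat)) index t))
        (All.lookup (proj₂ sat) (∈-filter⁺ (holds? B ρ) (∈-relAtoms i (map index t))
          (trans (cong (Rel B i) ρ-index-t) t∈)))
        where
        ρ-index-t : map ρ (map index t) ≡ t
        ρ-index-t = lookup-ext λ j → trans (Vecₚ.lookup-map j ρ (map index t))
          (trans (cong ρ (Vecₚ.lookup-map j index t)) (index-∈ (t⊆W j)))

  -- One element `b` is treated at a time: each of the `size A` values takes at most `witnesses A k`
  -- elements to refute, and a partial homomorphism exists on their union.
  obstructions⇒consistent : ∀ (A B : Structure σ) k →
    B ⊨ conjAI (obstructions A (size A * witnesses A k)) → ∀ b → Σ ∣ A ∣ (Consistency.S A B k b)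
  obstructions⇒consistent A B k B⊨ b = consistent A B k b W (λ a → ∈-concatMap (∈-elements (finite A) a))
    (obstructions⇒partialHom A _ B B⊨ b W (ℕₚ.≤-trans
      (length-concatMap-≤ _ (refutation-length A B k b) (elements (finite A)))
      (ℕₚ.≤-trans (ℕₚ.≤-reflexive (cong (_* witnesses A k) (length-elements (finite A)))) (ℕₚ.n≤1+n _))))
    where
    W : List ∣ B ∣
    W = concatMap (refutation A B k b) (elements (finite A))

theorem4p8 : (σ : Signature) → ((i : Fin (m σ)) → 1 ≤ arity σ i) →
    (K : Structure σ → Set) (A : Structure σ) → K A →
    PinchClosed K A → DisjointUnionClosed K →
    Σ (Sentence σ) (λ φ → Defines K A φ)
    ⇔ Σ (List (AntiIdentity σ)) (λ ψ → Defines K A (conjAI ψ))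
theorem4p8 σ arity≥1 K A _ pinchClosed unionClosed = mk⇔ to (λ (ψ , defines) → conjAI ψ , defines)
  where
  to : Σ (Sentence σ) (λ φ → Defines K A φ) → Σ (List (AntiIdentity σ)) (λ ψ → Defines K A (conjAI ψ))
  to (φ , defines) with definable⇒Chain σ arity≥1 K A pinchClosed unionClosed φ defines
  -- The chain has length `suc n′`, and consistency is checked for one round more, hence
  -- `suc (suc n′)`.
  ... | n′ , chain = obstructions A (size A * witnesses A (suc (suc n′))) , λ B _ → mk⇔
    (hom⇒obstructions A _ B)
    (λ B⊨ → Dismantle.hom-exists chain
      (consistentFamily chain (obstructions⇒consistent A B _ B⊨)) arity≥1 (s≤s z≤n))
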